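{- Let $\gamma>0$, $K>0$, $\epsilon>0$ be constants and let $n_0\in\mathbb{N}$. Then there exists $N$, depending only on $\gamma$, $K$, $\epsilon$ and $n_0$, such that the following holds. For each $n$ let $G=G_n$ be a simple undirected graph with $n$ vertices, $m=m_n$ edges and $t=t_n$ triangles, let $\Delta=\Delta_n$ be the size of the largest collection of triangles of $G$ having a common edge, and let $p=p_n\in[0,1]$. Suppose that for all $n\ge n_0$, $$\frac{p\,t}{\Delta}\ \ge\ \log^{6+\gamma} n \quad\text{if } p^2\Delta\ge 1,$$ and $$p^3 t\ \ge\ \log^{6+\gamma} n \quad\text{if } p^2\Delta<1 .$$ Let $G'$ be the random graph obtained from $G$ by keeping every edge independently with probability $p$ (and deleting it otherwise), and let $T$ be the number of triangles of $G'$. Then for all $n\ge N$, $$\Pr\big[\,|T-\mathbb{E}[T]|\ \ge\ \epsilon\,\mathbb{E}[T]\,\big]\ \le\ n^{ -K}.$$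
   Context: A triangle in a simple undirected graph is a set of three vertices that are pairwise adjacent (a fully connected subgraph on three nodes). For an edge $e$ of $G$, let $\Delta(e)$ be the number of triangles of $G$ that contain $e$; then $\Delta=\max_{e}\Delta(e)$, the maximum over all edges of $G$ (with $\Delta=0$ if $G$ has no edges). $\log$ is the natural logarithm, and $\log^{6+\gamma} n$ means $(\log n)^{6+\gamma}$. The random graph $G'$ has the same vertex set as $G$, and $T$ counts the (unweighted) triangles of $G'$. -}

module Defs where

open import Level using (0ℓ; suc; _⊔_)
open import Algebra.Bundles using (CommutativeRing)
open import Algebra.Apartness.Bundles using (HeytingField; HeytingCommutativeRing)
import Algebra.Apartness.Properties.HeytingCommutativeRing as HCRProperties
import Algebra.Properties.Ring as RingProperties
import Algebra.Properties.Semiring.Exp as SemiringExp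
import Algebra.Properties.Semiring.Mult as SemiringMult
open import Data.Fin.Base as Fin using (Fin)
import Data.Fin.Properties as Fin
open import Data.Fin.Subset using (Subset; inside; outside; ∣_∣; ∁; _∈_)
open import Data.Fin.Subset.Properties using (_∈?_)
open import Data.List.Base using (List; []; _∷_; _++_; map; filter; foldr; length; lookup; allFin; cartesianProduct)
open import Data.List.Extrema.Nat using (max)
import Data.List.Membership.DecPropositional as DecPropositionalMembership
import Data.List.Membership.Propositional as List
open import Data.List.Membership.Propositional.Properties using (∈-filter⁻; ∈-lookup)
open import Data.Nat.Base as ℕ using (ℕ; zero; NonZero)
open import Data.Product.Base using (∃; ∃-syntax; _×_; _,_; proj₁; proj₂)
open import Data.Product.Properties using (≡-dec)
open import Data.Sum.Base using (_⊎_; inj₁; inj₂; swap; [_,_]′)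
import Data.Vec.Base as Vec
open import Function.Base using (id)
open import Function.Bundles using (_⇔_; module Equivalence)
open import Relation.Binary.Core using (Rel)
open import Relation.Binary.Definitions using (Cotransitive; Symmetric; Irreflexive) renaming (Decidable to Decidable₂)
import Relation.Binary.PropositionalEquality.Core as ≡
open ≡ using (_≡_)
import Relation.Binary.Reasoning.Setoid as SetoidReasoning
open import Relation.Binary.Structures using (IsStrictPartialOrder)
open import Relation.Nullary using (¬_; contradiction)
open import Relation.Nullary.Decidable using (_×-dec_; _⊎-dec_)
open import Relation.Unary using (Pred; Decidable)

-- The real numbers, up to isomorphism: a Cauchy complete Archimedean ordered
-- field.  The axioms are constructive, so that Bishop's real numbers satisfy
-- them as well as the classical ones.  The absolute value, the exponential and
-- the logarithm are definable from the rest; their laws determine them.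

record Reals c ℓ₁ ℓ₂ : Set (suc (c ⊔ ℓ₁ ⊔ ℓ₂)) where
  infix 4 _<_ _≤_
  field
    heytingField : HeytingField c ℓ₁ ℓ₂

  open HeytingField heytingField public

  commutativeRing : CommutativeRing c ℓ₁
  commutativeRing = HeytingCommutativeRing.commutativeRing heytingCommutativeRing

  open CommutativeRing commutativeRing public
    using (ring; semiring)

  open SemiringExp semiring public using (_^_)
  open SemiringMult semiring using () renaming (_×_ to _·_)

  fromℕ : ℕ → Carrier
  fromℕ n = n · 1#

  field
    _<_                  : Rel Carrier ℓ₂
    isStrictPartialOrder : IsStrictPartialOrder _≈_ _<_
    #⇔<                  : ∀ {x y} → x # y ⇔ (x < y ⊎ y < x)
    +-monoˡ-<            : ∀ z {x y} → x < y → x + z < y + z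
    *-pos                : ∀ {x y} → 0# < x → 0# < y → 0# < x * y

  open IsStrictPartialOrder isStrictPartialOrder public
    using (<-resp-≈; <-respˡ-≈; <-respʳ-≈)
    renaming (irrefl to <-irrefl; trans to <-trans; asym to <-asym)

  _≤_ : Rel Carrier ℓ₂
  x ≤ y = ¬ (y < x)

  field
    archimedean : ∀ x → ∃[ n ] x < fromℕ n

  IsCauchy : (ℕ → Carrier) → Set (c ⊔ ℓ₂)
  IsCauchy a = ∀ ε → 0# < ε → ∃[ M ] ∀ i j → M ℕ.≤ i → M ℕ.≤ j → a i - a j < ε

  _ConvergesTo_ : (ℕ → Carrier) → Carrier → Set (c ⊔ ℓ₂)
  a ConvergesTo l = ∀ ε → 0# < ε → ∃[ M ] ∀ i → M ℕ.≤ i → a i - l < ε × l - a i < ε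

  field
    complete : ∀ a → IsCauchy a → ∃[ l ] a ConvergesTo l

    abs       : Carrier → Carrier
    abs-cong  : ∀ {x y} → x ≈ y → abs x ≈ abs y
    0≤x⇒abs≈x : ∀ {x} → 0# ≤ x → abs x ≈ x
    x≤0⇒abs≈- : ∀ {x} → x ≤ 0# → abs x ≈ - x

    -- exp x = exp (x / n) ^ n lies between (1 + x / n) ^ n and
    -- (1 - x / n) ^ (- n) for large n, so the last two laws force exp to be
    -- the exponential function with base e.
    exp      : Carrier → Carrier
    exp-cong : ∀ {x y} → x ≈ y → exp x ≈ exp y
    exp-+    : ∀ x y → exp (x + y) ≈ exp x * exp y
    1+x≤exp  : ∀ x → 1# + x ≤ exp x

    log     : ∀ x → 0# < x → Carrier
    exp-log : ∀ x (0<x : 0# < x) → exp (log x 0<x) ≈ x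

module RealProperties {c ℓ₁ ℓ₂} (ℝ : Reals c ℓ₁ ℓ₂) where
  open Reals ℝ public

  open HCRProperties heytingCommutativeRing using (1#0; x-0≈x)
  open RingProperties ring using (-‿distribʳ-*; -1*x≈-x; -‿involutive; -‿+-comm)
  open SetoidReasoning setoid

  <-cotrans : Cotransitive _<_
  <-cotrans x<y z with #-cotrans (Equivalence.from #⇔< (inj₁ x<y)) z
  ... | inj₁ x#z = [ inj₁ , (λ z<x → inj₂ (<-trans z<x x<y)) ]′ (Equivalence.to #⇔< x#z)
  ... | inj₂ z#y = [ inj₂ , (λ y<z → inj₁ (<-trans x<y y<z)) ]′ (Equivalence.to #⇔< z#y)

  ≤-<-trans : ∀ {x y z} → x ≤ y → y < z → x < z
  ≤-<-trans {x} x≤y y<z = [ (λ y<x → contradiction y<x x≤y) , id ]′ (<-cotrans y<z x)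

  x<y⇒0<y-x : ∀ {x y} → x < y → 0# < y - x
  x<y⇒0<y-x {x} x<y = <-respˡ-≈ (-‿inverseʳ x) (+-monoˡ-< (- x) x<y)

  0<y-x⇒x<y : ∀ {x y} → 0# < y - x → x < y
  0<y-x⇒x<y {x} {y} 0<y-x = <-respˡ-≈ (+-identityˡ x) (<-respʳ-≈ eq (+-monoˡ-< x 0<y-x))
    where
    eq : (y - x) + x ≈ y
    eq = begin
      (y - x) + x   ≈⟨ +-assoc y (- x) x ⟩
      y + (- x + x) ≈⟨ +-congˡ (-‿inverseˡ x) ⟩
      y + 0#        ≈⟨ +-identityʳ y ⟩
      y             ∎

  x<0⇒0<-x : ∀ {x} → x < 0# → 0# < - x
  x<0⇒0<-x {x} x<0 = <-respʳ-≈ (+-identityˡ (- x)) (x<y⇒0<y-x x<0)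

  *-monoʳ-< : ∀ {x y z} → 0# < z → x < y → z * x < z * y
  *-monoʳ-< {x} {y} {z} 0<z x<y = 0<y-x⇒x<y (<-respʳ-≈ eq (*-pos 0<z (x<y⇒0<y-x x<y)))
    where
    eq : z * (y - x) ≈ z * y - z * x
    eq = trans (distribˡ z y (- x)) (+-congˡ (sym (-‿distribʳ-* z x)))

  0<1 : 0# < 1#
  0<1 with Equivalence.to #⇔< 1#0
  ... | inj₂ 0<1 = 0<1
  ... | inj₁ 1<0 = contradiction (<-trans 1<0 (<-respʳ-≈ -1*-1≈1 (*-pos 0<-1 0<-1))) (<-irrefl refl)
    where
    0<-1 = x<0⇒0<-x 1<0
    -1*-1≈1 : (- 1#) * (- 1#) ≈ 1#
    -1*-1≈1 = trans (-1*x≈-x (- 1#)) (-‿involutive 1#)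

  0<1+n : ∀ n → 0# < fromℕ (ℕ.suc n)
  0<1+n zero      = <-respʳ-≈ (sym (+-identityʳ 1#)) 0<1
  0<1+n (ℕ.suc n) = <-trans (0<1+n n) (<-respˡ-≈ (+-identityˡ _) (+-monoˡ-< _ 0<1))

  1<2+n : ∀ n → 1# < fromℕ (ℕ.suc (ℕ.suc n))
  1<2+n n = <-respˡ-≈ (+-identityˡ 1#) (<-respʳ-≈ (+-comm _ 1#) (+-monoˡ-< 1# (0<1+n n)))

  infix 8 _⁻¹⟨_⟩
  _⁻¹⟨_⟩ : ∀ x → 0# < x → Carrier
  x ⁻¹⟨ 0<x ⟩ = proj₁ (#⇒invertible (Equivalence.from #⇔< (inj₂ 0<x)))

  *-inverseʳ : ∀ {x} (0<x : 0# < x) → x * x ⁻¹⟨ 0<x ⟩ ≈ 1#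
  *-inverseʳ {x} 0<x =
    trans (*-congʳ (sym (x-0≈x x))) (proj₂ (proj₂ (#⇒invertible (Equivalence.from #⇔< (inj₂ 0<x)))))

  0<⁻¹ : ∀ {x} (0<x : 0# < x) → 0# < x ⁻¹⟨ 0<x ⟩
  0<⁻¹ {x} 0<x = [ (λ u<0 → contradiction (neg u<0) (<-asym 0<1)) , id ]′ (Equivalence.to #⇔< u#0)
    where
    u = x ⁻¹⟨ 0<x ⟩

    u#0 : u # 0#
    u#0 = HCRProperties.invertibleˡ⇒# heytingCommutativeRing
      (x , trans (*-congˡ (x-0≈x u)) (*-inverseʳ 0<x))

    neg : u < 0# → 1# < 0#
    neg u<0 = <-respˡ-≈ (*-inverseʳ 0<x) (<-respʳ-≈ (zeroʳ x) (*-monoʳ-< 0<x u<0))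

  0<log : ∀ {x} (0<x : 0# < x) → 1# < x → 0# < log x 0<x
  0<log {x} 0<x 1<x = 0<y
    where
    y = log x 0<x
    u = x ⁻¹⟨ 0<x ⟩
    e = exp (- y)

    x*u≈1 : x * u ≈ 1#
    x*u≈1 = *-inverseʳ 0<x

    u<1 : u < 1#
    u<1 = <-respˡ-≈ (*-identityʳ u) (<-respʳ-≈ (trans (*-comm u x) x*u≈1) (*-monoʳ-< (0<⁻¹ 0<x) 1<x))

    x*[e*x]≈x : x * (e * x) ≈ x
    x*[e*x]≈x = begin
      x * (e * x)           ≈⟨ *-cong (exp-log x 0<x) (*-congˡ (exp-log x 0<x)) ⟨
      exp y * (e * exp y)   ≈⟨ *-congˡ (exp-+ (- y) y) ⟨
      exp y * exp (- y + y) ≈⟨ exp-+ y (- y + y) ⟨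
      exp (y + (- y + y))   ≈⟨ exp-cong (trans (+-congˡ (-‿inverseˡ y)) (+-identityʳ y)) ⟩
      exp y                 ≈⟨ exp-log x 0<x ⟩
      x                     ∎

    e≈u : e ≈ u
    e≈u = begin
      e                 ≈⟨ *-identityʳ e ⟨
      e * 1#            ≈⟨ *-congˡ x*u≈1 ⟨
      e * (x * u)       ≈⟨ *-assoc e x u ⟨
      e * x * u         ≈⟨ *-congʳ (*-identityˡ (e * x)) ⟨
      1# * (e * x) * u  ≈⟨ *-congʳ (*-congʳ (trans (*-comm u x) x*u≈1)) ⟨
      u * x * (e * x) * u   ≈⟨ *-congʳ (*-assoc u x (e * x)) ⟩
      u * (x * (e * x)) * u ≈⟨ *-congʳ (*-congˡ x*[e*x]≈x) ⟩
      u * x * u         ≈⟨ *-congʳ (trans (*-comm u x) x*u≈1) ⟩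
      1# * u            ≈⟨ *-identityˡ u ⟩
      u                 ∎

    1-y<1 : 1# - y < 1#
    1-y<1 = ≤-<-trans (1+x≤exp (- y)) (<-respˡ-≈ (sym e≈u) u<1)

    0<y : 0# < y
    0<y = <-respʳ-≈ eq (x<y⇒0<y-x 1-y<1)
      where
      eq : 1# - (1# - y) ≈ y
      eq = begin
        1# - (1# - y)       ≈⟨ +-congˡ (-‿+-comm 1# (- y)) ⟨
        1# + (- 1# - - y)   ≈⟨ +-congˡ (+-congˡ (-‿involutive y)) ⟩
        1# + (- 1# + y)     ≈⟨ +-assoc 1# (- 1#) y ⟨
        (1# - 1#) + y       ≈⟨ +-congʳ (-‿inverseʳ 1#) ⟩
        0# + y              ≈⟨ +-identityˡ y ⟩
        y                   ∎

  infixl 7 _/ℕ_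
  _/ℕ_ : Carrier → (d : ℕ) → .{{_ : NonZero d}} → Carrier
  x /ℕ (ℕ.suc d) = x * fromℕ (ℕ.suc d) ⁻¹⟨ 0<1+n d ⟩

  pow : ∀ x → 0# < x → Carrier → Carrier
  pow x 0<x y = exp (y * log x 0<x)

  -- log 0 and negative powers of 0 are undefined: the values at n = 0 are junk.
  -- At n = 1 the logarithm vanishes, and so do its positive powers.

  logPow : Carrier → ℕ → Carrier
  logPow y zero              = 0#
  logPow y (ℕ.suc zero)      = 0#
  logPow y (ℕ.suc (ℕ.suc n)) = pow (log (fromℕ (2 ℕ.+ n)) 0<2+n) (0<log 0<2+n (1<2+n n)) y
    where 0<2+n = 0<1+n (1 ℕ.+ n)

  powℕ : ℕ → Carrier → Carrier
  powℕ zero      y = 0#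
  powℕ (ℕ.suc n) y = pow (fromℕ (ℕ.suc n)) (0<1+n n) y

record SimpleGraph (n : ℕ) : Set₁ where
  infix 4 _~_ _~?_
  field
    _~_      : Rel (Fin n) 0ℓ
    _~?_     : Decidable₂ _~_
    ~-sym    : Symmetric _~_
    ~-irrefl : Irreflexive _≡_ _~_

module _ {n : ℕ} (G : SimpleGraph n) where
  open SimpleGraph G

  -- An edge is listed once, as the pair of its ends in increasing order, and a
  -- triangle once, as the increasing triple of its vertices.

  IsEdge : Pred (Fin n × Fin n) 0ℓ
  IsEdge (u , v) = u Fin.< v × u ~ v

  isEdge? : Decidable IsEdge
  isEdge? (u , v) = u Fin.<? v ×-dec u ~? v

  edges : List (Fin n × Fin n)
  edges = filter isEdge? (cartesianProduct (allFin n) (allFin n))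

  IsTriangle : Pred (Fin n × Fin n × Fin n) 0ℓ
  IsTriangle (u , v , w) = (u Fin.< v × v Fin.< w) × (u ~ v × v ~ w × u ~ w)

  isTriangle? : Decidable IsTriangle
  isTriangle? (u , v , w) =
    (u Fin.<? v ×-dec v Fin.<? w) ×-dec (u ~? v ×-dec v ~? w ×-dec u ~? w)

  triangles : List (Fin n × Fin n × Fin n)
  triangles =
    filter isTriangle? (cartesianProduct (allFin n) (cartesianProduct (allFin n) (allFin n)))

  #edges : ℕ
  #edges = length edges

  #triangles : ℕ
  #triangles = length triangles

  vertices : Fin n × Fin n × Fin n → List (Fin n)
  vertices (u , v , w) = u ∷ v ∷ w ∷ []

  Contains : Fin n × Fin n → Pred (Fin n × Fin n × Fin n) 0ℓ
  Contains (u , v) t = u List.∈ vertices t × v List.∈ vertices t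

  contains? : ∀ e → Decidable (Contains e)
  contains? (u , v) t = u ∈ᴸ? vertices t ×-dec v ∈ᴸ? vertices t
    where open DecPropositionalMembership Fin._≟_ renaming (_∈?_ to _∈ᴸ?_)

  #trianglesAt : Fin n × Fin n → ℕ
  #trianglesAt e = length (filter (contains? e) triangles)

  maxTrianglesAtEdge : ℕ
  maxTrianglesAtEdge = max 0 (map #trianglesAt edges)

  Joins : Fin #edges → Rel (Fin n) 0ℓ
  Joins i u v = lookup edges i ≡ (u , v) ⊎ lookup edges i ≡ (v , u)

  joins? : ∀ i → Decidable₂ (Joins i)
  joins? i u v = lookup edges i ≟ (u , v) ⊎-dec lookup edges i ≟ (v , u)
    where _≟_ = ≡-dec Fin._≟_ Fin._≟_

  loopless : ∀ i u → ¬ Joins i u u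
  loopless i u joins = Fin.<-irrefl ≡.refl (proj₁ (≡.subst IsEdge ([ id , id ]′ joins) isEdge))
    where
    allPairs : List (Fin n × Fin n)
    allPairs = cartesianProduct (allFin n) (allFin n)

    isEdge : IsEdge (lookup edges i)
    isEdge = proj₂ (∈-filter⁻ isEdge? {xs = allPairs} (∈-lookup {xs = edges} i))

  -- The spanning subgraph whose edges are those at the positions in S.

  subgraph : Subset #edges → SimpleGraph n
  subgraph S = record
    { _~_      = λ u v → ∃ λ i → i ∈ S × Joins i u v
    ; _~?_     = λ u v → Fin.any? λ i → i ∈? S ×-dec joins? i u v
    ; ~-sym    = λ (i , i∈S , joins) → i , i∈S , swap joins
    ; ~-irrefl = λ { {u} ≡.refl (i , _ , joins) → loopless i u joins }
    }

subsets : ∀ m → List (Subset m)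
subsets zero      = Vec.[] ∷ []
subsets (ℕ.suc m) = map (inside Vec.∷_) (subsets m) ++ map (outside Vec.∷_) (subsets m)

-- The probability space of m independent coins with success probability p: an
-- outcome is the set of successes.

module Coins {c ℓ₁ ℓ₂} (ℝ : Reals c ℓ₁ ℓ₂) (p : Reals.Carrier ℝ) (m : ℕ) where
  open RealProperties ℝ

  sum : List Carrier → Carrier
  sum = foldr _+_ 0#

  prob : Subset m → Carrier
  prob S = p ^ ∣ S ∣ * (1# - p) ^ ∣ ∁ S ∣

  𝔼 : (Subset m → Carrier) → Carrier
  𝔼 X = sum (map (λ S → prob S * X S) (subsets m))

  -- Summing over the outcomes in A requires a decision procedure for A.  One
  -- exists up to double negation, as there are finitely many outcomes, and an
  -- inequality Pr A? ≤ x, being itself negated, may be proved under a double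
  -- negation; so assuming A? is no restriction on A.

  Pr : ∀ {ℓ} {A : Pred (Subset m) ℓ} → Decidable A → Carrier
  Pr A? = sum (map prob (filter A? (subsets m)))

module RandomSubgraph
  {c ℓ₁ ℓ₂} (ℝ : Reals c ℓ₁ ℓ₂) {n : ℕ} (G : SimpleGraph n) (p : Reals.Carrier ℝ) where
  open RealProperties ℝ
  open Coins ℝ p (#edges G) public

  T : Subset (#edges G) → Carrier
  T S = fromℕ (#triangles (subgraph G S))

  Deviates : Carrier → Pred (Subset (#edges G)) ℓ₂
  Deviates ε S = ε * 𝔼 T ≤ abs (T S - 𝔼 T)

{-# OPTIONS --safe #-}

-- Write T for the sum, over the triangles t of G, of the product X t of the
-- indicators of the three edges of t, and μ = p³t for its mean.
--
-- Adding a set A of edges to the random set S increases X t by at most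
-- R A t S, which vanishes unless t meets A, and summing over all triangles
-- gives an expected increase of at most Q = 3(p²Δ|A| + |A|²), because an edge
-- lies in at most Δ triangles and two edges in at most one.
--
-- Upper tail: E[X t · Tʲ] is p³ times the mean of Tʲ with the edges of t added to
-- S, hence by induction E[Tᵏ] ≤ (μ + Q)ᵏ with |A| = 3k, and Markov's inequality
-- applies for k of order log n.
--
-- Lower tail: expand E[(1 - δ)^T] one triangle at a time.  The factor
-- contributed by a triangle is at most 1 - δp³(1 - δQ) with |A| = 3, as
-- (1 - δ)^T is a decreasing function of S.  This gives Janson's inequality.
--
-- Either case of the hypothesis says that μ ≥ log^(6+γ) n · max (1, p²Δ), and
-- already the exponent 3 would make both tails smaller than n^(-K-1).

module Submission where

open import Defs
open import Algebra.Bundles using (CommutativeRing; RawRing)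
import Algebra.Apartness.Properties.HeytingCommutativeRing as HCRProperties
import Algebra.Properties.AbelianGroup as AbelianGroupProperties
import Algebra.Properties.CommutativeSemigroup as CommutativeSemigroupProperties
import Algebra.Properties.CommutativeSemiring.Exp as CommutativeSemiringExp
import Algebra.Properties.Ring as RingProperties
import Algebra.Properties.Semiring.Exp as SemiringExp
import Algebra.Properties.Semiring.Mult as SemiringMult
import Algebra.Solver.Ring as RingSolver
open import Algebra.Solver.Ring.AlmostCommutativeRing using (fromCommutativeRing; _-Raw-AlmostCommutative⟶_)
open import Data.Bool.Base using (Bool; true; false)
open import Data.Fin.Base as Fin using (Fin; zero; suc)
import Data.Fin.Properties as Fin
open import Data.Fin.Subset using (Subset; inside; outside; ∣_∣; ∁)
open import Data.List.Base as List
  using (List; []; _∷_; _++_; map; filter; foldl; foldr; length; allFin; cartesianProduct)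
open import Data.List.Extrema.Nat using (xs≤max)
import Data.List.Membership.Propositional as List
open import Data.List.Membership.Propositional.Properties
  using (∈-filter⁺; ∈-filter⁻; ∈-lookup; ∈-map⁺; ∈-cartesianProduct⁺; ∈-allFin)
import Data.List.Properties as List
open import Data.List.Relation.Unary.All as All using (All; []; _∷_)
open import Data.List.Relation.Unary.AllPairs using ([]; _∷_)
open import Data.List.Relation.Unary.Any as Any using (here; there)
open import Data.List.Relation.Unary.Any.Properties using (lookup-index)
open import Data.List.Relation.Unary.Unique.Propositional using (Unique)
import Data.List.Relation.Unary.Unique.Propositional.Properties as Unique
open import Data.Maybe.Base using (Maybe; just; nothing)
open import Data.Nat.Base as ℕ using (ℕ; zero; suc; NonZero)
import Data.Nat.Properties as ℕ
open import Data.Product.Base using (∃-syntax; _×_; _,_; proj₁; proj₂)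
open import Data.Product.Properties using (,-injectiveˡ; ,-injectiveʳ)
open import Data.Sum.Base using (_⊎_; inj₁; inj₂)
open import Data.Vec.Base as Vec using ([]; _∷_; _[_]≔_)
open import Data.Vec.Properties using (lookup∘update; lookup∘update′; []=⇒lookup; lookup⇒[]=)
open import Function.Base using (_∘_)
open import Function.Bundles using (module Equivalence)
open import Level using (Level; _⊔_)
open import Relation.Binary.Bundles using (Poset)
import Relation.Binary.PropositionalEquality as ≡
open ≡ using (_≡_; _≢_)
import Relation.Binary.Reasoning.PartialOrder as PartialOrderReasoning
import Relation.Binary.Reasoning.Setoid as SetoidReasoning
open import Relation.Nullary using (¬_; yes; no; does; contradiction)
open import Relation.Unary using (Pred; Decidable)

-- Forcing edges replaces conditioning: by independence, the mean of an edge indicator times Y is p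
-- times the mean of Y with that edge added, so everything reduces to bounding the effect of added
-- edges. The constants come from a margin ρ with 4ρ ≤ min (1, ε). If Q ≤ ρμ for 3k forced edges,
-- Markov's inequality bounds the upper tail by ((1 + ρ) / (1 + 4ρ))^k ≤ exp (- ρk), and the same k,
-- with 1 - δ = exp (- k/μ), serves the lower tail. Taking k about c log n with ρc ≥ K + 1 gives
-- n^(-K-1), whose spare factor 1/n absorbs the two tails. The condition Q ≤ ρμ then asks for μ ≥ C
-- log² n max (1, p²Δ); a third logarithm pays for the constant C. As the reals are constructive,
-- comparisons and integer parts are undecidable. But `_≤_` is a negation, so while an inequality is
-- being proved they may be used in continuations that end in a negation.

-- A ring solver with integer coefficients

module CommutativeRingSolver {c ℓ} (R : CommutativeRing c ℓ) where
  open CommutativeRing R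
  open SemiringMult semiring using (×-homo-+; ×1-homo-*; ×-congˡ) renaming (_×_ to _·_)
  open RingProperties ring using (-0#≈0#; -‿distribˡ-*; -‿distribʳ-*; -‿involutive)

  private
    fromℕ : ℕ → Carrier
    fromℕ n = n · 1#

    open AbelianGroupProperties +-abelianGroup using (⁻¹-∙-comm)
    open CommutativeSemigroupProperties +-commutativeSemigroup using (interchange)
    open SetoidReasoning setoid

    -- The coefficients of the ring solver are formal differences of natural
    -- numbers.  Their values are computed after cancellation, so that equal
    -- differences have identical values, and so that 0#, 1# and fromℕ n occur
    -- literally in the interpretation of a polynomial.

    Difference : RawRing _ _
    Difference = record
      { Carrier = ℕ × ℕ
      ; _≈_     = _≡_
      ; _+_     = λ (a , b) (c , d) → a ℕ.+ c , b ℕ.+ d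
      ; _*_     = λ (a , b) (c , d) → a ℕ.* c ℕ.+ b ℕ.* d , a ℕ.* d ℕ.+ b ℕ.* c
      ; -_      = λ (a , b) → b , a
      ; 0#      = 0 , 0
      ; 1#      = 1 , 0
      }

    module D = RawRing Difference

    difference : ℕ × ℕ → Carrier
    difference (a , b) = fromℕ a - fromℕ b

    x-0≈x : ∀ x → x - 0# ≈ x
    x-0≈x x = trans (+-congˡ -0#≈0#) (+-identityʳ x)

    fromℕ-+ : ∀ m n → fromℕ (m ℕ.+ n) ≈ fromℕ m + fromℕ n
    fromℕ-+ = ×-homo-+ 1#

    minus-+ : ∀ a b c d → (a + c) - (b + d) ≈ (a - b) + (c - d)
    minus-+ a b c d = trans (+-congˡ (sym (⁻¹-∙-comm b d))) (interchange a c (- b) (- d))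

    a-b≈c-d : ∀ {a b c d} → a + d ≈ c + b → a - b ≈ c - d
    a-b≈c-d {a} {b} {c} {d} eq = begin
      a - b                 ≈⟨ +-identityʳ _ ⟨
      (a - b) + 0#          ≈⟨ +-congˡ (-‿inverseʳ d) ⟨
      (a - b) + (d - d)     ≈⟨ minus-+ a b d d ⟨
      (a + d) - (b + d)     ≈⟨ +-cong eq (-‿cong (+-comm b d)) ⟩
      (c + b) - (d + b)     ≈⟨ minus-+ c d b b ⟩
      (c - d) + (b - b)     ≈⟨ +-congˡ (-‿inverseʳ b) ⟩
      (c - d) + 0#          ≈⟨ +-identityʳ _ ⟩
      c - d                 ∎

    reducedValue : ℕ × ℕ → Carrier
    reducedValue (0 , 0)           = 0#
    reducedValue (1 , 0)           = 1#
    reducedValue (suc (suc a) , 0) = fromℕ (suc (suc a))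
    reducedValue (a , suc b)       = difference (a , suc b)

    reducedValue≈ : ∀ z → reducedValue z ≈ difference z
    reducedValue≈ (0 , 0)               = sym (x-0≈x 0#)
    reducedValue≈ (1 , 0)               = sym (trans (x-0≈x _) (+-identityʳ 1#))
    reducedValue≈ (suc (suc a) , 0)     = sym (x-0≈x _)
    reducedValue≈ (0 , suc b)           = refl
    reducedValue≈ (1 , suc b)           = refl
    reducedValue≈ (suc (suc a) , suc b) = refl

    -- Both sides are the larger of `a` and `b`; hence cancelling the common part of a formal
    -- difference keeps its value.
    ∸-+-comm : ∀ a b → a ℕ.∸ b ℕ.+ b ≡ a ℕ.+ (b ℕ.∸ a)
    ∸-+-comm a       zero    = ≡.cong (a ℕ.+_) (≡.sym (ℕ.0∸n≡0 a))
    ∸-+-comm zero    (suc b) = ≡.refl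
    ∸-+-comm (suc a) (suc b) = ≡.trans (ℕ.+-suc (a ℕ.∸ b) b) (≡.cong suc (∸-+-comm a b))

    value : ℕ × ℕ → Carrier
    value (a , b) = reducedValue (a ℕ.∸ b , b ℕ.∸ a)

    value≈ : ∀ z → value z ≈ difference z
    value≈ (a , b) = trans (reducedValue≈ (a ℕ.∸ b , b ℕ.∸ a)) (a-b≈c-d (begin
      fromℕ (a ℕ.∸ b) + fromℕ b    ≈⟨ fromℕ-+ (a ℕ.∸ b) b ⟨
      fromℕ (a ℕ.∸ b ℕ.+ b)        ≈⟨ ×-congˡ (∸-+-comm a b) ⟩
      fromℕ (a ℕ.+ (b ℕ.∸ a))      ≈⟨ fromℕ-+ a (b ℕ.∸ a) ⟩
      fromℕ a + fromℕ (b ℕ.∸ a)    ∎))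

    difference-+ : ∀ x y → difference (x D.+ y) ≈ difference x + difference y
    difference-+ (a , b) (c , d) = begin
      fromℕ (a ℕ.+ c) - fromℕ (b ℕ.+ d)         ≈⟨ +-cong (fromℕ-+ a c) (-‿cong (fromℕ-+ b d)) ⟩
      (fromℕ a + fromℕ c) - (fromℕ b + fromℕ d) ≈⟨ minus-+ _ _ _ _ ⟩
      difference (a , b) + difference (c , d)   ∎

    minus-* : ∀ a b c d → (a * c + b * d) - (a * d + b * c) ≈ (a - b) * (c - d)
    minus-* a b c d = begin
      (a * c + b * d) - (a * d + b * c)             ≈⟨ minus-+ _ _ _ _ ⟩
      (a * c - a * d) + (b * d - b * c)             ≈⟨ +-congˡ (+-comm _ _) ⟩
      (a * c - a * d) + (- (b * c) + b * d)         ≈⟨ +-congˡ (+-congˡ (-‿involutive _)) ⟨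
      (a * c - a * d) + (- (b * c) - - (b * d))     ≈⟨ +-cong (+-congˡ (-‿distribʳ-* a d))
                                                        (+-cong (-‿distribˡ-* b c) (-‿cong (-‿distribˡ-* b d))) ⟩
      (a * c + a * - d) + (- b * c - - b * d)       ≈⟨ +-congˡ (+-congˡ (-‿distribʳ-* (- b) d)) ⟩
      (a * c + a * - d) + (- b * c + - b * - d)     ≈⟨ +-cong (distribˡ a c (- d)) (distribˡ (- b) c (- d)) ⟨
      a * (c - d) + - b * (c - d)                   ≈⟨ distribʳ (c - d) a (- b) ⟨
      (a - b) * (c - d)                             ∎

    difference-* : ∀ x y → difference (x D.* y) ≈ difference x * difference y
    difference-* (a , b) (c , d) = trans (+-cong (eq a c b d) (-‿cong (eq a d b c))) (minus-* _ _ _ _)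
      where
      eq : ∀ i j k l → fromℕ (i ℕ.* j ℕ.+ k ℕ.* l) ≈ fromℕ i * fromℕ j + fromℕ k * fromℕ l
      eq i j k l = trans (fromℕ-+ (i ℕ.* j) (k ℕ.* l)) (+-cong (×1-homo-* i j) (×1-homo-* k l))

    difference-neg : ∀ x → difference (D.- x) ≈ - difference x
    difference-neg (a , b) = begin
      fromℕ b - fromℕ a       ≈⟨ +-comm _ _ ⟩
      - fromℕ a + fromℕ b     ≈⟨ +-congˡ (-‿involutive _) ⟨
      - fromℕ a - - fromℕ b   ≈⟨ ⁻¹-∙-comm _ _ ⟩
      - (fromℕ a - fromℕ b)   ∎

    value-homo : Difference -Raw-AlmostCommutative⟶ fromCommutativeRing R
    value-homo = record
      { ⟦_⟧    = value
      ; +-homo = λ x y → trans (value≈ (x D.+ y))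
                   (trans (difference-+ x y) (sym (+-cong (value≈ x) (value≈ y))))
      ; *-homo = λ x y → trans (value≈ (x D.* y))
                   (trans (difference-* x y) (sym (*-cong (value≈ x) (value≈ y))))
      ; -‿homo = λ x → trans (value≈ (D.- x)) (trans (difference-neg x) (-‿cong (sym (value≈ x))))
      ; 0-homo = refl
      ; 1-homo = refl
      }

    value-≟ : ∀ x y → Maybe (value x ≈ value y)
    value-≟ x@(a , b) y@(c , d) with a ℕ.+ d ℕ.≟ c ℕ.+ b
    ... | no  _       = nothing
    ... | yes a+d≡c+b = just (trans (value≈ x) (trans (a-b≈c-d eq) (sym (value≈ y))))
      where
      eq : fromℕ a + fromℕ d ≈ fromℕ c + fromℕ b
      eq = trans (sym (fromℕ-+ a d)) (trans (×-congˡ a+d≡c+b) (fromℕ-+ c b))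

  open RingSolver Difference (fromCommutativeRing R) value-homo value-≟ public
    using (Polynomial; solve; con; _:=_; _:+_; _:*_; _:-_; :-_; _:^_)

  infix 9 ⟪_⟫
  ⟪_⟫ : ∀ {n} → ℕ → Polynomial n
  ⟪ a ⟫ = con (a , 0)

-- Order laws of the reals

module OrderedField {c ℓ₁ ℓ₂} (ℝ : Reals c ℓ₁ ℓ₂) where
  open RealProperties ℝ public
  open SemiringMult semiring using (×1-homo-*)
  open SemiringExp semiring public using (^-congˡ)
  open CommutativeRingSolver commutativeRing public

  fromℕ-* : ∀ m n → fromℕ (m ℕ.* n) ≈ fromℕ m * fromℕ n
  fromℕ-* = ×1-homo-*

  ≤-reflexive : ∀ {x y} → x ≈ y → x ≤ y
  ≤-reflexive x≈y = <-irrefl (sym x≈y)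

  ≤-refl : ∀ {x} → x ≤ x
  ≤-refl = <-irrefl refl

  ≤-trans : ∀ {x y z} → x ≤ y → y ≤ z → x ≤ z
  ≤-trans {y = y} x≤y y≤z z<x with <-cotrans z<x y
  ... | inj₁ z<y = y≤z z<y
  ... | inj₂ y<x = x≤y y<x

  ≤-antisym : ∀ {x y} → x ≤ y → y ≤ x → x ≈ y
  ≤-antisym {x} {y} x≤y y≤x = proj₁ (tight x y) λ x#y → notApart (Equivalence.to #⇔< x#y)
    where
    notApart : ¬ (x < y ⊎ y < x)
    notApart (inj₁ x<y) = y≤x x<y
    notApart (inj₂ y<x) = x≤y y<x

  <⇒≤ : ∀ {x y} → x < y → x ≤ y
  <⇒≤ = <-asym

  <-≤-trans : ∀ {x y z} → x < y → y ≤ z → x < z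
  <-≤-trans {z = z} x<y y≤z with <-cotrans x<y z
  ... | inj₁ x<z = x<z
  ... | inj₂ z<y = contradiction z<y y≤z

  ≤-poset : Poset c ℓ₁ ℓ₂
  ≤-poset = record
    { Carrier = Carrier
    ; _≈_     = _≈_
    ; _≤_     = _≤_
    ; isPartialOrder = record
      { isPreorder = record
        { isEquivalence = isEquivalence
        ; reflexive     = ≤-reflexive
        ; trans         = ≤-trans
        }
      ; antisym = ≤-antisym
      }
    }

  module ≤-Reasoning = PartialOrderReasoning ≤-poset

  -- As _≤_ is a negation, an inequality may be proved by classical case
  -- distinction.

  ≤-cases : ∀ {a} {A : Set a} x y → (x ≤ y → ¬ A) → (y ≤ x → ¬ A) → ¬ A
  ≤-cases x y f g a = f (λ y<x → g (<⇒≤ y<x) a) a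

  <-cases : ∀ {a} {A : Set a} x y → (x < y → ¬ A) → (y ≤ x → ¬ A) → ¬ A
  <-cases x y f g a = g (λ x<y → f x<y a) a

  +-monoˡ-≤ : ∀ z {x y} → x ≤ y → x + z ≤ y + z
  +-monoˡ-≤ z {x} {y} x≤y y+z<x+z =
    x≤y (<-respˡ-≈ (cancel y) (<-respʳ-≈ (cancel x) (+-monoˡ-< (- z) y+z<x+z)))
    where
    cancel : ∀ w → (w + z) - z ≈ w
    cancel w = solve 2 (λ w z → (w :+ z) :- z := w) refl w z

  +-monoʳ-≤ : ∀ z {x y} → x ≤ y → z + x ≤ z + y
  +-monoʳ-≤ z x≤y = ≤-trans (≤-reflexive (+-comm z _)) (≤-trans (+-monoˡ-≤ z x≤y) (≤-reflexive (+-comm _ z)))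

  +-mono-≤ : ∀ {x y u v} → x ≤ y → u ≤ v → x + u ≤ y + v
  +-mono-≤ x≤y u≤v = ≤-trans (+-monoˡ-≤ _ x≤y) (+-monoʳ-≤ _ u≤v)

  x≤y⇒0≤y-x : ∀ {x y} → x ≤ y → 0# ≤ y - x
  x≤y⇒0≤y-x {x} x≤y = ≤-trans (≤-reflexive (sym (-‿inverseʳ x))) (+-monoˡ-≤ (- x) x≤y)

  0≤y-x⇒x≤y : ∀ {x y} → 0# ≤ y - x → x ≤ y
  0≤y-x⇒x≤y {x} {y} 0≤y-x = begin
    x            ≈⟨ +-identityˡ x ⟨
    0# + x       ≤⟨ +-monoˡ-≤ x 0≤y-x ⟩
    (y - x) + x  ≈⟨ solve 2 (λ x y → (y :- x) :+ x := y) refl x y ⟩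
    y            ∎
    where open ≤-Reasoning

  neg-mono-≤ : ∀ {x y} → x ≤ y → - y ≤ - x
  neg-mono-≤ {x} {y} x≤y = 0≤y-x⇒x≤y (≤-trans (x≤y⇒0≤y-x x≤y)
    (≤-reflexive (solve 2 (λ x y → y :- x := :- x :- :- y) refl x y)))

  +-nonneg : ∀ {x y} → 0# ≤ x → 0# ≤ y → 0# ≤ x + y
  +-nonneg 0≤x 0≤y = ≤-trans (≤-reflexive (sym (+-identityʳ 0#))) (+-mono-≤ 0≤x 0≤y)

  -- The axiom covers positive factors only; a non-negative factor that is not positive is zero by
  -- antisymmetry.
  *-nonneg : ∀ {x y} → 0# ≤ x → 0# ≤ y → 0# ≤ x * y
  *-nonneg {x} {y} 0≤x 0≤y =
    <-cases 0# x (λ 0<x → <-cases 0# y (λ 0<y → <⇒≤ (*-pos 0<x 0<y))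
      (λ y≤0 → ≤-reflexive (sym (trans (*-congˡ (≤-antisym y≤0 0≤y)) (zeroʳ x)))))
      (λ x≤0 → ≤-reflexive (sym (trans (*-congʳ (≤-antisym x≤0 0≤x)) (zeroˡ y))))

  *-monoʳ-≤ : ∀ {x y z} → 0# ≤ z → x ≤ y → z * x ≤ z * y
  *-monoʳ-≤ {x} {y} {z} 0≤z x≤y = 0≤y-x⇒x≤y (≤-trans (*-nonneg 0≤z (x≤y⇒0≤y-x x≤y))
    (≤-reflexive (solve 3 (λ x y z → z :* (y :- x) := z :* y :- z :* x) refl x y z)))

  *-monoˡ-≤ : ∀ {x y z} → 0# ≤ z → x ≤ y → x * z ≤ y * z
  *-monoˡ-≤ 0≤z x≤y = ≤-trans (≤-reflexive (*-comm _ _)) (≤-trans (*-monoʳ-≤ 0≤z x≤y) (≤-reflexive (*-comm _ _)))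

  *-mono-≤ : ∀ {x y u v} → 0# ≤ x → 0# ≤ v → x ≤ y → u ≤ v → x * u ≤ y * v
  *-mono-≤ 0≤x 0≤v x≤y u≤v = ≤-trans (*-monoʳ-≤ 0≤x u≤v) (*-monoˡ-≤ 0≤v x≤y)

  *-cancelˡ-≤ : ∀ {x y z} → 0# < z → z * x ≤ z * y → x ≤ y
  *-cancelˡ-≤ 0<z zx≤zy y<x = zx≤zy (*-monoʳ-< 0<z y<x)

  0≤1 : 0# ≤ 1#
  0≤1 = <⇒≤ 0<1

  ^-nonneg : ∀ n {x} → 0# ≤ x → 0# ≤ x ^ n
  ^-nonneg zero    0≤x = 0≤1
  ^-nonneg (suc n) 0≤x = *-nonneg 0≤x (^-nonneg n 0≤x)

  ^-mono-≤ : ∀ n {x y} → 0# ≤ x → x ≤ y → x ^ n ≤ y ^ n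
  ^-mono-≤ zero    0≤x x≤y = ≤-refl
  ^-mono-≤ (suc n) 0≤x x≤y = *-mono-≤ 0≤x (^-nonneg n (≤-trans 0≤x x≤y)) x≤y (^-mono-≤ n 0≤x x≤y)

  1≤x⇒1≤x^n : ∀ n {x} → 1# ≤ x → 1# ≤ x ^ n
  1≤x⇒1≤x^n zero    1≤x = ≤-refl
  1≤x⇒1≤x^n (suc n) 1≤x = ≤-trans (≤-reflexive (sym (*-identityʳ 1#)))
    (*-mono-≤ 0≤1 (^-nonneg n (≤-trans 0≤1 1≤x)) 1≤x (1≤x⇒1≤x^n n 1≤x))

  0≤fromℕ : ∀ n → 0# ≤ fromℕ n
  0≤fromℕ zero    = ≤-refl
  0≤fromℕ (suc n) = <⇒≤ (0<1+n n)

  fromℕ-mono-≤ : ∀ {m n} → m ℕ.≤ n → fromℕ m ≤ fromℕ n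
  fromℕ-mono-≤ {n = n} ℕ.z≤n = 0≤fromℕ n
  fromℕ-mono-≤ (ℕ.s≤s m≤n)    = +-monoʳ-≤ 1# (fromℕ-mono-≤ m≤n)

  -- Comparison of `x` with an integer is undecidable, so the integer part is found only up to
  -- double negation, by descent from an Archimedean bound.
  ¬¬-floor : ∀ {x} → 0# ≤ x → ¬ ¬ (∃[ l ] fromℕ l ≤ x × x < fromℕ (suc l))
  ¬¬-floor {x} 0≤x with archimedean x
  ... | b , x<b = below b x<b
    where
    below : ∀ b → x < fromℕ b → ¬ ¬ (∃[ l ] fromℕ l ≤ x × x < fromℕ (suc l))
    below zero    x<0   = contradiction x<0 0≤x
    below (suc b) x<1+b = <-cases x (fromℕ b) (below b) (λ b≤x none → none (b , b≤x , x<1+b))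

-- The exponential function

module Exponential {c ℓ₁ ℓ₂} (ℝ : Reals c ℓ₁ ℓ₂) where
  open OrderedField ℝ
  open ≤-Reasoning

  square-nonneg : ∀ x → 0# ≤ x * x
  square-nonneg x = ≤-cases 0# x (λ 0≤x → *-nonneg 0≤x 0≤x)
    (λ x≤0 → let 0≤-x = ≤-trans (x≤y⇒0≤y-x x≤0) (≤-reflexive (+-identityˡ (- x))) in
      ≤-trans (*-nonneg 0≤-x 0≤-x) (≤-reflexive (solve 1 (λ x → :- x :* :- x := x :* x) refl x)))

  exp-nonneg : ∀ x → 0# ≤ exp x
  exp-nonneg x = begin
    0#              ≤⟨ square-nonneg (exp h) ⟩
    exp h * exp h   ≈⟨ exp-+ h h ⟨
    exp (h + h)     ≈⟨ exp-cong h+h≈x ⟩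
    exp x           ∎
    where
    ½ = fromℕ 2 ⁻¹⟨ 0<1+n 1 ⟩
    h = x * ½
    h+h≈x : h + h ≈ x
    h+h≈x = begin-equality
      h + h             ≈⟨ solve 2 (λ x h → x :* h :+ x :* h := x :* (⟪ 2 ⟫ :* h)) refl x ½ ⟩
      x * (fromℕ 2 * ½) ≈⟨ *-congˡ (*-inverseʳ (0<1+n 1)) ⟩
      x * 1#            ≈⟨ *-identityʳ x ⟩
      x                 ∎

  exp-0 : exp 0# ≈ 1#
  exp-0 = ≤-antisym (*-cancelˡ-≤ 0<exp0 (≤-reflexive exp0²≈exp0)) (*-cancelˡ-≤ 0<exp0 (≤-reflexive (sym exp0²≈exp0)))
    where
    0<exp0 : 0# < exp 0#
    0<exp0 = <-≤-trans 0<1 (≤-trans (≤-reflexive (sym (+-identityʳ 1#))) (1+x≤exp 0#))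
    exp0²≈exp0 : exp 0# * exp 0# ≈ exp 0# * 1#
    exp0²≈exp0 = trans (sym (exp-+ 0# 0#)) (trans (exp-cong (+-identityʳ 0#)) (sym (*-identityʳ _)))

  exp-inverse : ∀ x → exp (- x) * exp x ≈ 1#
  exp-inverse x = trans (sym (exp-+ (- x) x)) (trans (exp-cong (-‿inverseˡ x)) exp-0)

  -- Non-negativity does not yield positivity constructively; being invertible, `exp x` is apart
  -- from zero, and only the positive side remains.
  0<exp : ∀ x → 0# < exp x
  0<exp x with Equivalence.to #⇔< (invertibleˡ⇒# (exp (- x) , trans (*-congˡ (x-0≈x _)) (exp-inverse x)))
    where open HCRProperties heytingCommutativeRing using (invertibleˡ⇒#; x-0≈x)
  ... | inj₁ exp<0 = contradiction exp<0 (exp-nonneg x)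
  ... | inj₂ 0<exp = 0<exp

  exp-mono-≤ : ∀ {x y} → x ≤ y → exp x ≤ exp y
  exp-mono-≤ {x} {y} x≤y = begin
    exp x                 ≈⟨ *-identityʳ _ ⟨
    exp x * 1#            ≈⟨ *-congˡ (+-identityʳ 1#) ⟨
    exp x * (1# + 0#)     ≤⟨ *-monoʳ-≤ (exp-nonneg x) (≤-trans (+-monoʳ-≤ 1# (x≤y⇒0≤y-x x≤y)) (1+x≤exp _)) ⟩
    exp x * exp (y - x)   ≈⟨ exp-+ x (y - x) ⟨
    exp (x + (y - x))     ≈⟨ exp-cong (solve 2 (λ x y → x :+ (y :- x) := y) refl x y) ⟩
    exp y                 ∎

  exp-cancel-≤ : ∀ {x y} → exp x ≤ exp y → x ≤ y
  exp-cancel-≤ {x} {y} exp-x≤exp-y y<x = exp≤ 1<exp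
    where
    exp≤ : exp (x - y) ≤ 1#
    exp≤ = *-cancelˡ-≤ (0<exp y) (begin
      exp y * exp (x - y)   ≈⟨ exp-+ y (x - y) ⟨
      exp (y + (x - y))     ≈⟨ exp-cong (solve 2 (λ x y → y :+ (x :- y) := x) refl x y) ⟩
      exp x                 ≤⟨ exp-x≤exp-y ⟩
      exp y                 ≈⟨ *-identityʳ _ ⟨
      exp y * 1#            ∎)
    1<exp : 1# < exp (x - y)
    1<exp = <-≤-trans (<-respˡ-≈ (+-identityˡ 1#) (<-respʳ-≈ (+-comm _ _) (+-monoˡ-< 1# (x<y⇒0<y-x y<x))))
      (1+x≤exp (x - y))

  exp-^ : ∀ n x → exp x ^ n ≈ exp (fromℕ n * x)
  exp-^ zero    x = sym (trans (exp-cong (zeroˡ x)) exp-0)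
  exp-^ (suc n) x = begin-equality
    exp x * exp x ^ n           ≈⟨ *-congˡ (exp-^ n x) ⟩
    exp x * exp (fromℕ n * x)   ≈⟨ exp-+ x _ ⟨
    exp (x + fromℕ n * x)       ≈⟨ exp-cong (solve 2 (λ x n → x :+ n :* x := (⟪ 1 ⟫ :+ n) :* x) refl x (fromℕ n)) ⟩
    exp (fromℕ (suc n) * x)     ∎

-- Finite sums

module FiniteSums {c ℓ₁ ℓ₂} (ℝ : Reals c ℓ₁ ℓ₂) where
  open OrderedField ℝ

  private variable
    a b : Level
    A : Set a
    B : Set b

  -- Unfolds to the same term as the sums in `𝔼` and `Pr`, so the laws below apply to these without
  -- conversion.
  ∑ : List A → (A → Carrier) → Carrier
  ∑ xs f = foldr _+_ 0# (map f xs)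

  infix 5 ∑
  syntax ∑ xs (λ x → e) = ∑[ x ∈ xs ] e

  ∑-cong : ∀ (xs : List A) {f g} → (∀ x → f x ≈ g x) → ∑ xs f ≈ ∑ xs g
  ∑-cong []       f≈g = refl
  ∑-cong (x ∷ xs) f≈g = +-cong (f≈g x) (∑-cong xs f≈g)

  ∑-mono : ∀ (xs : List A) {f g} → (∀ x → f x ≤ g x) → ∑ xs f ≤ ∑ xs g
  ∑-mono []       f≤g = ≤-refl
  ∑-mono (x ∷ xs) f≤g = +-mono-≤ (f≤g x) (∑-mono xs f≤g)

  ∑-nonneg : ∀ (xs : List A) {f} → (∀ x → 0# ≤ f x) → 0# ≤ ∑ xs f
  ∑-nonneg []       0≤f = ≤-refl
  ∑-nonneg (x ∷ xs) 0≤f = +-nonneg (0≤f x) (∑-nonneg xs 0≤f)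

  ∑-+ : ∀ (xs : List A) f g → ∑[ x ∈ xs ] (f x + g x) ≈ ∑ xs f + ∑ xs g
  ∑-+ []       f g = sym (+-identityʳ 0#)
  ∑-+ (x ∷ xs) f g = trans (+-congˡ (∑-+ xs f g))
    (solve 4 (λ a b c d → (a :+ b) :+ (c :+ d) := (a :+ c) :+ (b :+ d)) refl (f x) (g x) _ _)

  ∑-*ˡ : ∀ (xs : List A) c f → ∑[ x ∈ xs ] (c * f x) ≈ c * ∑ xs f
  ∑-*ˡ []       c f = sym (zeroʳ c)
  ∑-*ˡ (x ∷ xs) c f = trans (+-congˡ (∑-*ˡ xs c f)) (sym (distribˡ c (f x) _))

  ∑-*ʳ : ∀ (xs : List A) f c → ∑[ x ∈ xs ] (f x * c) ≈ ∑ xs f * c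
  ∑-*ʳ xs f c = trans (∑-cong xs λ x → *-comm (f x) c) (trans (∑-*ˡ xs c f) (*-comm c _))

  ∑-const : ∀ (xs : List A) c → ∑[ x ∈ xs ] c ≈ fromℕ (length xs) * c
  ∑-const []       c = sym (zeroˡ c)
  ∑-const (x ∷ xs) c = trans (+-congˡ (∑-const xs c))
    (solve 2 (λ c n → c :+ n :* c := (⟪ 1 ⟫ :+ n) :* c) refl c _)

  ∑-comm : ∀ (xs : List A) (ys : List B) (f : A → B → Carrier) →
    ∑[ x ∈ xs ] (∑[ y ∈ ys ] f x y) ≈ ∑[ y ∈ ys ] (∑[ x ∈ xs ] f x y)
  ∑-comm []       ys f = sym (trans (∑-const ys 0#) (zeroʳ _))
  ∑-comm (x ∷ xs) ys f = trans (+-congˡ (∑-comm xs ys f)) (sym (∑-+ ys (f x) _))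

  ∑-++ : ∀ (xs ys : List A) f → ∑ (xs ++ ys) f ≈ ∑ xs f + ∑ ys f
  ∑-++ []       ys f = sym (+-identityˡ _)
  ∑-++ (x ∷ xs) ys f = trans (+-congˡ (∑-++ xs ys f)) (sym (+-assoc (f x) _ _))

  ∑-map : ∀ (h : A → B) xs f → ∑ (map h xs) f ≈ ∑ xs (f ∘ h)
  ∑-map h []       f = refl
  ∑-map h (x ∷ xs) f = +-congˡ (∑-map h xs f)

-- Independent coins and forced edges

record Probability {c ℓ₁ ℓ₂} (ℝ : Reals c ℓ₁ ℓ₂) : Set (c ⊔ ℓ₂) where
  open Reals ℝ
  field
    p   : Carrier
    0≤p : 0# ≤ p
    p≤1 : p ≤ 1#

module Expectation {c ℓ₁ ℓ₂} (ℝ : Reals c ℓ₁ ℓ₂) (P : Probability ℝ) where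

  open OrderedField ℝ
  open Probability P
  open FiniteSums ℝ
  open Coins ℝ p using (prob; 𝔼; Pr)
  open ≤-Reasoning

  private variable
    a : Level
    A : Set a
    m : ℕ

  q : Carrier
  q = 1# - p

  0≤q : 0# ≤ q
  0≤q = x≤y⇒0≤y-x p≤1

  -- Averages one coin at a time, which turns the laws of expectation, and independence in `E-χ`,
  -- into inductions on the number of coins.
  E : ∀ m → (Subset m → Carrier) → Carrier
  E zero    X = X []
  E (suc m) X = p * E m (X ∘ (inside ∷_)) + q * E m (X ∘ (outside ∷_))

  𝔼≈E : ∀ m X → 𝔼 m X ≈ E m X
  𝔼≈E zero    X = solve 1 (λ x → ⟪ 1 ⟫ :* ⟪ 1 ⟫ :* x :+ ⟪ 0 ⟫ := x) refl (X [])
  𝔼≈E (suc m) X = begin-equality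
    ∑ (map (inside ∷_) (subsets m) ++ map (outside ∷_) (subsets m)) (λ S → prob (suc m) S * X S)
      ≈⟨ ∑-++ (map (inside ∷_) (subsets m)) _ _ ⟩
    ∑ (map (inside ∷_) (subsets m)) (λ S → prob (suc m) S * X S)
      + ∑ (map (outside ∷_) (subsets m)) (λ S → prob (suc m) S * X S)
      ≈⟨ +-cong (∑-map (inside ∷_) (subsets m) _) (∑-map (outside ∷_) (subsets m) _) ⟩
    (∑[ S ∈ subsets m ] (prob (suc m) (inside ∷ S) * X (inside ∷ S)))
      + (∑[ S ∈ subsets m ] (prob (suc m) (outside ∷ S) * X (outside ∷ S)))
      ≈⟨ +-cong
          (∑-cong (subsets m) λ S → solve 4 (λ p x y z → p :* x :* y :* z := p :* (x :* y :* z)) refl p _ _ _)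
          (∑-cong (subsets m) λ S → solve 4 (λ q x y z → x :* (q :* y) :* z := q :* (x :* y :* z)) refl q _ _ _) ⟩
    (∑[ S ∈ subsets m ] (p * (prob m S * X (inside ∷ S))))
      + (∑[ S ∈ subsets m ] (q * (prob m S * X (outside ∷ S))))
      ≈⟨ +-cong (∑-*ˡ (subsets m) p _) (∑-*ˡ (subsets m) q _) ⟩
    p * 𝔼 m (X ∘ (inside ∷_)) + q * 𝔼 m (X ∘ (outside ∷_))
      ≈⟨ +-cong (*-congˡ (𝔼≈E m _)) (*-congˡ (𝔼≈E m _)) ⟩
    E (suc m) X ∎

  prob-nonneg : ∀ (S : Subset m) → 0# ≤ prob m S
  prob-nonneg S = *-nonneg (^-nonneg ∣ S ∣ 0≤p) (^-nonneg ∣ ∁ S ∣ 0≤q)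

  markov : ∀ {ℓ} {P : Pred (Subset m) ℓ} (P? : Decidable P) X →
    (∀ S → 0# ≤ X S) → (∀ S → P S → 1# ≤ X S) → Pr m P? ≤ E m X
  markov {m = m} P? X 0≤X 1≤X = ≤-trans (go (subsets m)) (≤-reflexive (𝔼≈E m X))
    where
    go : ∀ Ss → ∑ (filter P? Ss) (prob m) ≤ ∑[ S ∈ Ss ] (prob m S * X S)
    go []       = ≤-refl
    go (S ∷ Ss) with P? S
    ... | yes PS = +-mono-≤ (≤-trans (≤-reflexive (sym (*-identityʳ _))) (*-monoʳ-≤ (prob-nonneg S) (1≤X S PS))) (go Ss)
    ... | no  _  = ≤-trans (≤-reflexive (sym (+-identityˡ _))) (+-mono-≤ (*-nonneg (prob-nonneg S) (0≤X S)) (go Ss))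

  E-mono : ∀ m {X Y} → (∀ S → X S ≤ Y S) → E m X ≤ E m Y
  E-mono zero    X≤Y = X≤Y []
  E-mono (suc m) X≤Y =
    +-mono-≤ (*-monoʳ-≤ 0≤p (E-mono m (X≤Y ∘ (inside ∷_)))) (*-monoʳ-≤ 0≤q (E-mono m (X≤Y ∘ (outside ∷_))))

  E-cong : ∀ m {X Y} → (∀ S → X S ≈ Y S) → E m X ≈ E m Y
  E-cong m X≈Y = ≤-antisym (E-mono m (≤-reflexive ∘ X≈Y)) (E-mono m (≤-reflexive ∘ sym ∘ X≈Y))

  E-+ : ∀ m X Y → E m (λ S → X S + Y S) ≈ E m X + E m Y
  E-+ zero    X Y = refl
  E-+ (suc m) X Y = trans (+-cong (*-congˡ (E-+ m _ _)) (*-congˡ (E-+ m _ _)))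
    (solve 6 (λ p q a b c d → p :* (a :+ b) :+ q :* (c :+ d) := (p :* a :+ q :* c) :+ (p :* b :+ q :* d)) refl p q _ _ _ _)

  E-* : ∀ m x X → E m (λ S → x * X S) ≈ x * E m X
  E-* zero    x X = refl
  E-* (suc m) x X = trans (+-cong (*-congˡ (E-* m x _)) (*-congˡ (E-* m x _)))
    (solve 5 (λ p q x a b → p :* (x :* a) :+ q :* (x :* b) := x :* (p :* a :+ q :* b)) refl p q x _ _)

  E-const : ∀ m x → E m (λ _ → x) ≈ x
  E-const zero    x = refl
  E-const (suc m) x = trans (+-cong (*-congˡ (E-const m x)) (*-congˡ (E-const m x)))
    (solve 2 (λ p x → p :* x :+ (⟪ 1 ⟫ :- p) :* x := x) refl p x)

  E-nonneg : ∀ m {X} → (∀ S → 0# ≤ X S) → 0# ≤ E m X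
  E-nonneg m 0≤X = ≤-trans (≤-reflexive (sym (E-const m 0#))) (E-mono m 0≤X)

  E-∑ : ∀ m (xs : List A) (X : A → Subset m → Carrier) → E m (λ S → ∑[ x ∈ xs ] X x S) ≈ ∑[ x ∈ xs ] E m (X x)
  E-∑ m []       X = E-const m 0#
  E-∑ m (x ∷ xs) X = trans (E-+ m (X x) _) (+-congˡ (E-∑ m xs X))

  ι : Bool → Carrier
  ι true  = 1#
  ι false = 0#

  0≤ι : ∀ b → 0# ≤ ι b
  0≤ι true  = 0≤1
  0≤ι false = ≤-refl

  ι≤1 : ∀ b → ι b ≤ 1#
  ι≤1 true  = ≤-refl
  ι≤1 false = 0≤1

  χ : Fin m → Subset m → Carrier
  χ e S = ι (Vec.lookup S e)

  0≤χ : ∀ e (S : Subset m) → 0# ≤ χ e S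
  0≤χ e S = 0≤ι (Vec.lookup S e)

  χ≤1 : ∀ e (S : Subset m) → χ e S ≤ 1#
  χ≤1 e S = ι≤1 (Vec.lookup S e)

  infixl 6 _⊕_ _⊕*_

  _⊕_ : Subset m → Fin m → Subset m
  S ⊕ e = S [ e ]≔ inside

  _⊕*_ : Subset m → List (Fin m) → Subset m
  S ⊕* A = foldl _⊕_ S A

  -- This is independence: `X (S ⊕ e)` does not depend on coin `e`, and agrees with `X S` where that
  -- coin succeeds.
  E-χ : ∀ {m} e (X : Subset m → Carrier) → E m (λ S → χ e S * X S) ≈ p * E m (λ S → X (S ⊕ e))
  E-χ {suc m} zero X = begin-equality
    p * E m (λ S → 1# * X (inside ∷ S)) + q * E m (λ S → 0# * X (outside ∷ S))
      ≈⟨ +-cong (*-congˡ (E-* m 1# _)) (*-congˡ (E-* m 0# _)) ⟩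
    p * (1# * E m (X ∘ (inside ∷_))) + q * (0# * E m (X ∘ (outside ∷_)))
      -- Adding `zero` gives `inside` for either value of the first coin, so the weight 1 is split
      -- as p + (1 - p) to restore an average over all coins.
      ≈⟨ solve 3 (λ p a b → p :* (⟪ 1 ⟫ :* a) :+ (⟪ 1 ⟫ :- p) :* (⟪ 0 ⟫ :* b)
                         := p :* (p :* a :+ (⟪ 1 ⟫ :- p) :* a)) refl p _ _ ⟩
    p * (p * E m (X ∘ (inside ∷_)) + q * E m (X ∘ (inside ∷_)))
      ∎
  E-χ {suc m} (suc e) X = begin-equality
    p * E m (λ S → χ e S * X (inside ∷ S)) + q * E m (λ S → χ e S * X (outside ∷ S))
      ≈⟨ +-cong (*-congˡ (E-χ e _)) (*-congˡ (E-χ e _)) ⟩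
    p * (p * E m (λ S → X (inside ∷ (S ⊕ e)))) + q * (p * E m (λ S → X (outside ∷ (S ⊕ e))))
      ≈⟨ solve 4 (λ p q a b → p :* (p :* a) :+ q :* (p :* b) := p :* (p :* a :+ q :* b)) refl p q _ _ ⟩
    p * (p * E m (λ S → X (inside ∷ (S ⊕ e))) + q * E m (λ S → X (outside ∷ (S ⊕ e))))
      ∎

  χ-⊕-≢ : ∀ {e e′ : Fin m} → e ≢ e′ → ∀ S → χ e (S ⊕ e′) ≈ χ e S
  χ-⊕-≢ e≢e′ S = reflexive (≡.cong ι (lookup∘update′ e≢e′ S inside))

  χ-⊕-≡ : ∀ (e : Fin m) S → χ e (S ⊕ e) ≈ 1#
  χ-⊕-≡ e S = reflexive (≡.cong ι (lookup∘update e S inside))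

  -- Distinctness keeps the second indicator unchanged when the first edge is forced. The list is
  -- reversed because the edge treated last is the first to be added.
  E-χχ : ∀ {e e′ : Fin m} → e ≢ e′ → ∀ (X : Subset m → Carrier) →
    E m (λ S → χ e S * (χ e′ S * X S)) ≈ p ^ 2 * E m (λ S → X (S ⊕* (e′ ∷ e ∷ [])))
  E-χχ {m = m} {e} {e′} e≢e′ X = begin-equality
    E m (λ S → χ e S * (χ e′ S * X S))         ≈⟨ E-χ e _ ⟩
    p * E m (λ S → χ e′ (S ⊕ e) * X (S ⊕ e))   ≈⟨ *-congˡ (E-cong m λ S → *-congʳ (χ-⊕-≢ (e≢e′ ∘ ≡.sym) S)) ⟩
    p * E m (λ S → χ e′ S * X (S ⊕ e))         ≈⟨ *-congˡ (E-χ e′ _) ⟩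
    p * (p * E m (λ S → X (S ⊕ e′ ⊕ e)))       ≈⟨ solve 2 (λ p x → p :* (p :* x) := p :^ 2 :* x) refl p _ ⟩
    p ^ 2 * E m (λ S → X (S ⊕ e′ ⊕ e))         ∎

  E-χχχ : ∀ {e e′ e″ : Fin m} → e ≢ e′ → e ≢ e″ → e′ ≢ e″ → ∀ (X : Subset m → Carrier) →
    E m (λ S → χ e S * (χ e′ S * (χ e″ S * X S))) ≈ p ^ 3 * E m (λ S → X (S ⊕* (e″ ∷ e′ ∷ e ∷ [])))
  E-χχχ {m = m} {e} {e′} {e″} e≢e′ e≢e″ e′≢e″ X = begin-equality
    E m (λ S → χ e S * (χ e′ S * (χ e″ S * X S)))
      ≈⟨ E-χ e _ ⟩
    p * E m (λ S → χ e′ (S ⊕ e) * (χ e″ (S ⊕ e) * X (S ⊕ e)))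
      ≈⟨ *-congˡ (E-cong m λ S → *-cong (χ-⊕-≢ (e≢e′ ∘ ≡.sym) S) (*-congʳ (χ-⊕-≢ (e≢e″ ∘ ≡.sym) S))) ⟩
    p * E m (λ S → χ e′ S * (χ e″ S * X (S ⊕ e)))
      ≈⟨ *-congˡ (E-χχ e′≢e″ _) ⟩
    p * (p ^ 2 * E m (λ S → X (S ⊕ e″ ⊕ e′ ⊕ e)))
      ≈⟨ *-assoc p (p ^ 2) _ ⟨
    p ^ 3 * E m (λ S → X (S ⊕ e″ ⊕ e′ ⊕ e))
      ∎

  χ-⊕-mono : ∀ e e′ (S : Subset m) → χ e S ≤ χ e (S ⊕ e′)
  χ-⊕-mono e e′ S with e Fin.≟ e′
  ... | yes ≡.refl = ≤-trans (χ≤1 e S) (≤-reflexive (sym (χ-⊕-≡ e S)))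
  ... | no  e≢e′   = ≤-reflexive (sym (χ-⊕-≢ e≢e′ S))

  [_≡_] : Fin m → Fin m → Carrier
  [ e ≡ e′ ] = ι (does (e Fin.≟ e′))

  χ-⊕-≤ : ∀ e e′ (S : Subset m) → χ e (S ⊕ e′) ≤ χ e S + [ e′ ≡ e ]
  χ-⊕-≤ e e′ S with e′ Fin.≟ e
  ... | yes ≡.refl = begin
    χ e (S ⊕ e)   ≈⟨ χ-⊕-≡ e S ⟩
    1#            ≈⟨ +-identityˡ 1# ⟨
    0# + 1#       ≤⟨ +-monoˡ-≤ 1# (0≤χ e S) ⟩
    χ e S + 1#    ∎
  ... | no  e′≢e   = ≤-reflexive (trans (χ-⊕-≢ (e′≢e ∘ ≡.sym) S) (sym (+-identityʳ _)))

  -- Edges are added as a list, so that repeated edges count with multiplicity;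
  -- this only weakens the bounds.

  mult : List (Fin m) → Fin m → Carrier
  mult A e = ∑[ e′ ∈ A ] [ e′ ≡ e ]

  0≤mult : ∀ A (e : Fin m) → 0# ≤ mult A e
  0≤mult A e = ∑-nonneg A (λ e′ → 0≤ι (does (e′ Fin.≟ e)))

  χ-⊕*-mono : ∀ A e (S : Subset m) → χ e S ≤ χ e (S ⊕* A)
  χ-⊕*-mono []       e S = ≤-refl
  χ-⊕*-mono (e′ ∷ A) e S = ≤-trans (χ-⊕-mono e e′ S) (χ-⊕*-mono A e (S ⊕ e′))

  χ-⊕*-≤ : ∀ A e (S : Subset m) → χ e (S ⊕* A) ≤ χ e S + mult A e
  χ-⊕*-≤ []       e S = ≤-reflexive (sym (+-identityʳ _))
  χ-⊕*-≤ (e′ ∷ A) e S = begin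
    χ e (S ⊕ e′ ⊕* A)                     ≤⟨ χ-⊕*-≤ A e (S ⊕ e′) ⟩
    χ e (S ⊕ e′) + mult A e               ≤⟨ +-monoˡ-≤ _ (χ-⊕-≤ e e′ S) ⟩
    χ e S + [ e′ ≡ e ] + mult A e         ≈⟨ +-assoc _ _ _ ⟩
    χ e S + ([ e′ ≡ e ] + mult A e)       ∎

-- Triples of edges and the moments of their number

-- A triangle as the probabilistic argument sees it: three distinct coins. How triangles overlap
-- enters only later, through `Sparse`.
record Triple (m : ℕ) : Set where
  field
    e₁ e₂ e₃ : Fin m
    e₁≢e₂    : e₁ ≢ e₂
    e₁≢e₃    : e₁ ≢ e₃
    e₂≢e₃    : e₂ ≢ e₃

module Triples {c ℓ₁ ℓ₂} (ℝ : Reals c ℓ₁ ℓ₂) (P : Probability ℝ) (m : ℕ) where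

  open OrderedField ℝ
  open Probability P
  open FiniteSums ℝ
  open Expectation ℝ P
  open Triple
  open ≤-Reasoning

  X : Triple m → Subset m → Carrier
  X t S = χ (e₁ t) S * (χ (e₂ t) S * χ (e₃ t) S)

  T : List (Triple m) → Subset m → Carrier
  T ts S = ∑[ t ∈ ts ] X t S

  pairs : List (Fin m) → Triple m → Carrier
  pairs A t = mult A (e₁ t) * mult A (e₂ t) + mult A (e₁ t) * mult A (e₃ t) + mult A (e₂ t) * mult A (e₃ t)

  -- R bounds the increase of X t when the edges in A are added to S, and r its
  -- expectation.

  R : List (Fin m) → Triple m → Subset m → Carrier
  R A t S = mult A (e₁ t) * (χ (e₂ t) S * χ (e₃ t) S) + mult A (e₂ t) * (χ (e₁ t) S * χ (e₃ t) S)
    + mult A (e₃ t) * (χ (e₁ t) S * χ (e₂ t) S) + pairs A t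

  r : List (Fin m) → Triple m → Carrier
  r A t = p ^ 2 * (mult A (e₁ t) + mult A (e₂ t) + mult A (e₃ t)) + pairs A t

  private
    0≤p³ : 0# ≤ p ^ 3
    0≤p³ = ^-nonneg 3 0≤p

  0≤X : ∀ t S → 0# ≤ X t S
  0≤X t S = *-nonneg (0≤χ (e₁ t) S) (*-nonneg (0≤χ (e₂ t) S) (0≤χ (e₃ t) S))

  X≤1 : ∀ t S → X t S ≤ 1#
  X≤1 t S = begin
    χ (e₁ t) S * (χ (e₂ t) S * χ (e₃ t) S)
      ≤⟨ *-mono-≤ (0≤χ (e₁ t) S) 0≤1*1 (χ≤1 (e₁ t) S) (*-mono-≤ (0≤χ (e₂ t) S) 0≤1 (χ≤1 (e₂ t) S) (χ≤1 (e₃ t) S)) ⟩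
    1# * (1# * 1#)
      ≈⟨ trans (*-identityˡ _) (*-identityˡ _) ⟩
    1# ∎
    where 0≤1*1 = *-nonneg 0≤1 0≤1

  X-⊕*-mono : ∀ A t S → X t S ≤ X t (S ⊕* A)
  X-⊕*-mono A t S = *-mono-≤ (0≤χ (e₁ t) S) (*-nonneg (0≤χ (e₂ t) (S ⊕* A)) (0≤χ (e₃ t) (S ⊕* A))) (χ-⊕*-mono A (e₁ t) S)
    (*-mono-≤ (0≤χ (e₂ t) S) (0≤χ (e₃ t) (S ⊕* A)) (χ-⊕*-mono A (e₂ t) S) (χ-⊕*-mono A (e₃ t) S))

  0≤pairs : ∀ A t → 0# ≤ pairs A t
  0≤pairs A t = +-nonneg (+-nonneg (*-nonneg (0≤mult A (e₁ t)) (0≤mult A (e₂ t)))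
    (*-nonneg (0≤mult A (e₁ t)) (0≤mult A (e₃ t)))) (*-nonneg (0≤mult A (e₂ t)) (0≤mult A (e₃ t)))

  0≤R : ∀ A t S → 0# ≤ R A t S
  0≤R A t S = +-nonneg (+-nonneg (+-nonneg
    (*-nonneg (0≤mult A (e₁ t)) (*-nonneg (0≤χ (e₂ t) S) (0≤χ (e₃ t) S)))
    (*-nonneg (0≤mult A (e₂ t)) (*-nonneg (0≤χ (e₁ t) S) (0≤χ (e₃ t) S))))
    (*-nonneg (0≤mult A (e₃ t)) (*-nonneg (0≤χ (e₁ t) S) (0≤χ (e₂ t) S)))) (0≤pairs A t)

  0≤r : ∀ A t → 0# ≤ r A t
  0≤r A t = +-nonneg (*-nonneg (^-nonneg 2 0≤p)
    (+-nonneg (+-nonneg (0≤mult A (e₁ t)) (0≤mult A (e₂ t))) (0≤mult A (e₃ t)))) (0≤pairs A t)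

  private
    -- Multiplying out (x + a)(y + b)(z + c) would leave a cubic term abc. It is avoided by using z′
    -- ≤ 1 in the term a b z′ and z′ ≤ z + c in the other three.
    product-bound : ∀ {x y z x′ y′ z′ a b c} →
      0# ≤ x → 0# ≤ y → 0# ≤ y′ → 0# ≤ z′ → 0# ≤ a → 0# ≤ b → 0# ≤ c →
      x ≤ 1# → y ≤ 1# → z′ ≤ 1# →
      x′ ≤ x + a → y′ ≤ y + b → z′ ≤ z + c →
      x′ * (y′ * z′) ≤ x * (y * z) + (a * (y * z) + b * (x * z) + c * (x * y) + (a * b + a * c + b * c))
    product-bound {x} {y} {z} {x′} {y′} {z′} {a} {b} {c}
      0≤x 0≤y 0≤y′ 0≤z′ 0≤a 0≤b 0≤c x≤1 y≤1 z′≤1 x′≤ y′≤ z′≤ = begin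
      x′ * (y′ * z′)
        ≤⟨ *-monoˡ-≤ (*-nonneg 0≤y′ 0≤z′) x′≤ ⟩
      (x + a) * (y′ * z′)
        ≤⟨ *-monoʳ-≤ (+-nonneg 0≤x 0≤a) (*-monoˡ-≤ 0≤z′ y′≤) ⟩
      (x + a) * ((y + b) * z′)
        ≈⟨ solve 5 (λ x a y b z′ → (x :+ a) :* ((y :+ b) :* z′)
             := x :* y :* z′ :+ x :* b :* z′ :+ a :* y :* z′ :+ a :* b :* z′) refl x a y b z′ ⟩
      x * y * z′ + x * b * z′ + a * y * z′ + a * b * z′
        ≤⟨ +-mono-≤ (+-mono-≤ (+-mono-≤
             (*-monoʳ-≤ (*-nonneg 0≤x 0≤y) z′≤) (*-monoʳ-≤ (*-nonneg 0≤x 0≤b) z′≤))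
             (*-monoʳ-≤ (*-nonneg 0≤a 0≤y) z′≤)) (*-monoʳ-≤ (*-nonneg 0≤a 0≤b) z′≤1) ⟩
      x * y * (z + c) + x * b * (z + c) + a * y * (z + c) + a * b * 1#
        ≈⟨ solve 6 (λ x a y b z c →
             x :* y :* (z :+ c) :+ x :* b :* (z :+ c) :+ a :* y :* (z :+ c) :+ a :* b :* ⟪ 1 ⟫
             := (x :* (y :* z) :+ (a :* (y :* z) :+ b :* (x :* z) :+ c :* (x :* y) :+ a :* b))
                :+ (y :* (a :* c) :+ x :* (b :* c)))
             refl x a y b z c ⟩
      (x * (y * z) + (a * (y * z) + b * (x * z) + c * (x * y) + a * b)) + (y * (a * c) + x * (b * c))
        ≤⟨ +-monoʳ-≤ _ (+-mono-≤ (*-monoˡ-≤ (*-nonneg 0≤a 0≤c) y≤1) (*-monoˡ-≤ (*-nonneg 0≤b 0≤c) x≤1)) ⟩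
      (x * (y * z) + (a * (y * z) + b * (x * z) + c * (x * y) + a * b)) + (1# * (a * c) + 1# * (b * c))
        ≈⟨ solve 6 (λ x a y b z c →
             (x :* (y :* z) :+ (a :* (y :* z) :+ b :* (x :* z) :+ c :* (x :* y) :+ a :* b))
               :+ (⟪ 1 ⟫ :* (a :* c) :+ ⟪ 1 ⟫ :* (b :* c))
             := x :* (y :* z) :+ (a :* (y :* z) :+ b :* (x :* z) :+ c :* (x :* y)
               :+ (a :* b :+ a :* c :+ b :* c)))
             refl x a y b z c ⟩
      x * (y * z) + (a * (y * z) + b * (x * z) + c * (x * y) + (a * b + a * c + b * c))
        ∎

  X-⊕*-≤ : ∀ A t S → X t (S ⊕* A) ≤ X t S + R A t S
  X-⊕*-≤ A t S = product-bound
    (0≤χ (e₁ t) S) (0≤χ (e₂ t) S) (0≤χ (e₂ t) (S ⊕* A)) (0≤χ (e₃ t) (S ⊕* A))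
    (0≤mult A (e₁ t)) (0≤mult A (e₂ t)) (0≤mult A (e₃ t))
    (χ≤1 (e₁ t) S) (χ≤1 (e₂ t) S) (χ≤1 (e₃ t) (S ⊕* A))
    (χ-⊕*-≤ A (e₁ t) S) (χ-⊕*-≤ A (e₂ t) S) (χ-⊕*-≤ A (e₃ t) S)

  -- For Y that is not much increased by adding up to three edges, X t and R A t
  -- are as good as independent of Y.

  module _ {Y : Subset m → Carrier} {C : Carrier} (Y≤C : ∀ A → length A ℕ.≤ 3 → E m (λ S → Y (S ⊕* A)) ≤ C) where

    E-X* : ∀ t → E m (λ S → X t S * Y S) ≤ p ^ 3 * C
    E-X* t = begin
      E m (λ S → X t S * Y S)
        ≈⟨ E-cong m (λ S → solve 4 (λ x y z w → x :* (y :* z) :* w := x :* (y :* (z :* w))) refl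
             (χ (e₁ t) S) (χ (e₂ t) S) (χ (e₃ t) S) (Y S)) ⟩
      E m (λ S → χ (e₁ t) S * (χ (e₂ t) S * (χ (e₃ t) S * Y S)))
        ≈⟨ E-χχχ (e₁≢e₂ t) (e₁≢e₃ t) (e₂≢e₃ t) Y ⟩
      p ^ 3 * E m (λ S → Y (S ⊕* (e₃ t ∷ e₂ t ∷ e₁ t ∷ [])))
        ≤⟨ *-monoʳ-≤ 0≤p³ (Y≤C (e₃ t ∷ e₂ t ∷ e₁ t ∷ []) ℕ.≤-refl) ⟩
      p ^ 3 * C
        ∎

    E-R* : ∀ A t → E m (λ S → R A t S * Y S) ≤ r A t * C
    E-R* A t = begin
      E m (λ S → R A t S * Y S)
        ≈⟨ E-cong m (λ S → solve 8 (λ a b c κ x y z w →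
             (a :* (y :* z) :+ b :* (x :* z) :+ c :* (x :* y) :+ κ) :* w
             := a :* (y :* (z :* w)) :+ (b :* (x :* (z :* w)) :+ (c :* (x :* (y :* w)) :+ κ :* w)))
             refl a₁ a₂ a₃ κ (χ₁ S) (χ₂ S) (χ₃ S) (Y S)) ⟩
      E m (λ S → a₁ * (χ₂ S * (χ₃ S * Y S)) + (a₂ * (χ₁ S * (χ₃ S * Y S)) + (a₃ * (χ₁ S * (χ₂ S * Y S)) + κ * Y S)))
        ≈⟨ trans (E-+ m _ _) (+-congˡ (trans (E-+ m _ _) (+-congˡ (E-+ m _ _)))) ⟩
      E m (λ S → a₁ * (χ₂ S * (χ₃ S * Y S))) + (E m (λ S → a₂ * (χ₁ S * (χ₃ S * Y S)))
        + (E m (λ S → a₃ * (χ₁ S * (χ₂ S * Y S))) + E m (λ S → κ * Y S)))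
        ≤⟨ +-mono-≤ (term a₁ (0≤mult A (e₁ t)) (e₂≢e₃ t)) (+-mono-≤ (term a₂ (0≤mult A (e₂ t)) (e₁≢e₃ t))
             (+-mono-≤ (term a₃ (0≤mult A (e₃ t)) (e₁≢e₂ t))
               (≤-trans (≤-reflexive (E-* m κ Y)) (*-monoʳ-≤ (0≤pairs A t) (Y≤C [] ℕ.z≤n))))) ⟩
      a₁ * (p ^ 2 * C) + (a₂ * (p ^ 2 * C) + (a₃ * (p ^ 2 * C) + κ * C))
        ≈⟨ solve 6 (λ a b c κ p² C → a :* (p² :* C) :+ (b :* (p² :* C) :+ (c :* (p² :* C) :+ κ :* C))
             := (p² :* (a :+ b :+ c) :+ κ) :* C) refl a₁ a₂ a₃ κ (p ^ 2) C ⟩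
      r A t * C
        ∎
      where
      a₁ = mult A (e₁ t)
      a₂ = mult A (e₂ t)
      a₃ = mult A (e₃ t)
      χ₁ = χ (e₁ t)
      χ₂ = χ (e₂ t)
      χ₃ = χ (e₃ t)
      κ  = pairs A t
      term : ∀ a → 0# ≤ a → ∀ {e e′} → e ≢ e′ → E m (λ S → a * (χ e S * (χ e′ S * Y S))) ≤ a * (p ^ 2 * C)
      term a 0≤a {e} {e′} e≢e′ = begin
        E m (λ S → a * (χ _ S * (χ _ S * Y S)))      ≈⟨ E-* m a _ ⟩
        a * E m (λ S → χ _ S * (χ _ S * Y S))        ≈⟨ *-congˡ (E-χχ e≢e′ Y) ⟩
        a * (p ^ 2 * E m (λ S → Y (S ⊕* (e′ ∷ e ∷ [])))) ≤⟨ *-monoʳ-≤ 0≤a (*-monoʳ-≤ (^-nonneg 2 0≤p) (Y≤C (e′ ∷ e ∷ []) (ℕ.m≤n+m 2 1))) ⟩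
        a * (p ^ 2 * C)                              ∎

    E-∑R* : ∀ A ts → E m (λ S → (∑[ t ∈ ts ] R A t S) * Y S) ≤ ∑ ts (r A) * C
    E-∑R* A ts = begin
      E m (λ S → (∑[ t ∈ ts ] R A t S) * Y S)   ≈⟨ E-cong m (λ S → ∑-*ʳ ts (λ t → R A t S) (Y S)) ⟨
      E m (λ S → ∑[ t ∈ ts ] (R A t S * Y S))   ≈⟨ E-∑ m ts (λ t S → R A t S * Y S) ⟩
      ∑[ t ∈ ts ] E m (λ S → R A t S * Y S)     ≤⟨ ∑-mono ts (λ t → E-R* A t) ⟩
      ∑[ t ∈ ts ] (r A t * C)                   ≈⟨ ∑-*ʳ ts (r A) C ⟩
      ∑ ts (r A) * C                            ∎

  -- Here `n` is the budget of forced edges: 3k for the k-th moment, 3 for the lower tail.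
  Bounded : Carrier → ℕ → List (Triple m) → Set _
  Bounded Q n ts = ∀ A → length A ℕ.≤ n → ∑ ts (r A) ≤ Q

  0≤T : ∀ ts S → 0# ≤ T ts S
  0≤T ts S = ∑-nonneg ts (λ t → 0≤X t S)

  E-T : ∀ ts → E m (T ts) ≈ p ^ 3 * fromℕ (length ts)
  E-T ts = begin-equality
    E m (T ts)                              ≈⟨ E-∑ m ts X ⟩
    ∑[ t ∈ ts ] E m (X t)                   ≈⟨ ∑-cong ts E-X ⟩
    ∑[ t ∈ ts ] (p ^ 3)                     ≈⟨ ∑-const ts (p ^ 3) ⟩
    fromℕ (length ts) * p ^ 3               ≈⟨ *-comm _ _ ⟩
    p ^ 3 * fromℕ (length ts)               ∎
    where
    E-X : ∀ t → E m (X t) ≈ p ^ 3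
    E-X t = begin-equality
      E m (X t)
        ≈⟨ E-cong m (λ S → solve 3 (λ x y z → x :* (y :* z) := x :* (y :* (z :* ⟪ 1 ⟫))) refl
             (χ (e₁ t) S) (χ (e₂ t) S) (χ (e₃ t) S)) ⟩
      E m (λ S → χ (e₁ t) S * (χ (e₂ t) S * (χ (e₃ t) S * 1#)))
        ≈⟨ E-χχχ (e₁≢e₂ t) (e₁≢e₃ t) (e₂≢e₃ t) (λ _ → 1#) ⟩
      p ^ 3 * E m (λ _ → 1#)
        ≈⟨ trans (*-congˡ (E-const m 1#)) (*-identityʳ _) ⟩
      p ^ 3 ∎

  -- Induction on `j` needs the edges `A` forced so far as a parameter: splitting off one factor T
  -- forces the three edges of a triple in the remaining power. The hypothesis on lengths reserves
  -- three edges for each factor still to come.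
  moment : ∀ {Q n} ts → Bounded Q n ts → ∀ j A → length A ℕ.+ 3 ℕ.* j ℕ.≤ n →
    E m (λ S → T ts (S ⊕* A) ^ j) ≤ (p ^ 3 * fromℕ (length ts) + Q) ^ j
  moment         ts bounded zero    A ∣A∣≤n = ≤-reflexive (E-const m 1#)
  moment {Q} {n} ts bounded (suc j) A ∣A∣≤n = begin
    E m (λ S → T ts (S ⊕* A) * Y S)
      ≤⟨ E-mono m (λ S → *-monoˡ-≤ (0≤Y S) (≤-trans (∑-mono ts (λ t → X-⊕*-≤ A t S)) (≤-reflexive (∑-+ ts _ _)))) ⟩
    E m (λ S → (T ts S + (∑[ t ∈ ts ] R A t S)) * Y S)
      ≈⟨ trans (E-cong m (λ S → distribʳ (Y S) _ _)) (E-+ m _ _) ⟩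
    E m (λ S → T ts S * Y S) + E m (λ S → (∑[ t ∈ ts ] R A t S) * Y S)
      ≤⟨ +-mono-≤ T-part (≤-trans (E-∑R* Y≤M^j A ts) (*-monoˡ-≤ 0≤M^j (bounded A ∣A∣≤n′))) ⟩
    p ^ 3 * fromℕ (length ts) * M ^ j + Q * M ^ j
      ≈⟨ distribʳ (M ^ j) _ Q ⟨
    M ^ suc j
      ∎
    where
    M = p ^ 3 * fromℕ (length ts) + Q

    Y : Subset m → Carrier
    Y S = T ts (S ⊕* A) ^ j

    0≤Y : ∀ S → 0# ≤ Y S
    0≤Y S = ^-nonneg j (0≤T ts (S ⊕* A))

    ∣A∣≤n′ : length A ℕ.≤ n
    ∣A∣≤n′ = ℕ.≤-trans (ℕ.m≤m+n (length A) _) ∣A∣≤n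

    length-bound : ∀ B → length B ℕ.≤ 3 → length (B ++ A) ℕ.+ 3 ℕ.* j ℕ.≤ n
    length-bound B ∣B∣≤3 = ℕ.≤-trans (ℕ.≤-trans (ℕ.≤-reflexive eq₁) (ℕ.+-monoˡ-≤ _ ∣B∣≤3))
      (ℕ.≤-trans (ℕ.≤-reflexive eq₂) ∣A∣≤n)
      where
      eq₁ : length (B ++ A) ℕ.+ 3 ℕ.* j ≡ length B ℕ.+ (length A ℕ.+ 3 ℕ.* j)
      eq₁ = ≡.trans (≡.cong (ℕ._+ 3 ℕ.* j) (List.length-++ B)) (ℕ.+-assoc (length B) _ _)
      eq₂ : 3 ℕ.+ (length A ℕ.+ 3 ℕ.* j) ≡ length A ℕ.+ 3 ℕ.* suc j
      eq₂ = ≡.trans (≡.sym (ℕ.+-assoc 3 (length A) _)) (≡.trans (≡.cong (ℕ._+ 3 ℕ.* j) (ℕ.+-comm 3 (length A)))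
        (≡.trans (ℕ.+-assoc (length A) 3 _) (≡.cong (length A ℕ.+_) (≡.sym (ℕ.*-suc 3 j)))))

    -- Adding `B` and then `A` is adding `B ++ A`, so the induction hypothesis applies with up to
    -- three more forced edges and one factor less.
    Y≤M^j : ∀ B → length B ℕ.≤ 3 → E m (λ S → Y (S ⊕* B)) ≤ M ^ j
    Y≤M^j B ∣B∣≤3 = ≤-trans
      (≤-reflexive (E-cong m λ S → reflexive (≡.cong (λ S′ → T ts S′ ^ j) (≡.sym (List.foldl-++ _⊕_ S B A)))))
      (moment ts bounded j (B ++ A) (length-bound B ∣B∣≤3))

    -- The sign is read off from the bound itself, since the power dominates the mean of a
    -- non-negative function.
    0≤M^j : 0# ≤ M ^ j
    0≤M^j = ≤-trans (E-nonneg m 0≤Y) (Y≤M^j [] ℕ.z≤n)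

    T-part : E m (λ S → T ts S * Y S) ≤ p ^ 3 * fromℕ (length ts) * M ^ j
    T-part = begin
      E m (λ S → T ts S * Y S)               ≈⟨ E-cong m (λ S → ∑-*ʳ ts (λ t → X t S) (Y S)) ⟨
      E m (λ S → ∑[ t ∈ ts ] (X t S * Y S))  ≈⟨ E-∑ m ts (λ t S → X t S * Y S) ⟩
      ∑[ t ∈ ts ] E m (λ S → X t S * Y S)    ≤⟨ ∑-mono ts (E-X* Y≤M^j) ⟩
      ∑[ t ∈ ts ] (p ^ 3 * M ^ j)            ≈⟨ ∑-const ts _ ⟩
      fromℕ (length ts) * (p ^ 3 * M ^ j)    ≈⟨ solve 3 (λ l x y → l :* (x :* y) := x :* l :* y) refl _ (p ^ 3) (M ^ j) ⟩
      p ^ 3 * fromℕ (length ts) * M ^ j      ∎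

-- The mean of (1 - δ)^T

module LowerTail {c ℓ₁ ℓ₂} (ℝ : Reals c ℓ₁ ℓ₂) (P : Probability ℝ) (m : ℕ) where

  open OrderedField ℝ
  open Probability P
  open FiniteSums ℝ
  open Expectation ℝ P
  open Exponential ℝ
  open Triple
  open Triples ℝ P m
  open ≤-Reasoning

  X≈0⊎X≈1 : ∀ t S → X t S ≈ 0# ⊎ X t S ≈ 1#
  X≈0⊎X≈1 t S with Vec.lookup S (e₁ t) | Vec.lookup S (e₂ t) | Vec.lookup S (e₃ t)
  ... | false | _     | _     = inj₁ (zeroˡ _)
  ... | true  | false | _     = inj₁ (trans (*-congˡ (zeroˡ _)) (zeroʳ _))
  ... | true  | true  | false = inj₁ (trans (*-congˡ (zeroʳ _)) (zeroʳ _))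
  ... | true  | true  | true  = inj₂ (trans (*-identityˡ _) (*-identityˡ _))

  -- As X t is 0 or 1, F ts is the power (1 - δ) ^ T ts.

  module _ {δ : Carrier} (0≤δ : 0# ≤ δ) (δ≤1 : δ ≤ 1#) where

    F : List (Triple m) → Subset m → Carrier
    F []       S = 1#
    F (t ∷ ts) S = (1# - δ * X t S) * F ts S

    private
      0≤1-δx : ∀ {x} → 0# ≤ x → x ≤ 1# → 0# ≤ 1# - δ * x
      0≤1-δx {x} 0≤x x≤1 = x≤y⇒0≤y-x (begin
        δ * x     ≤⟨ *-mono-≤ 0≤δ 0≤1 δ≤1 x≤1 ⟩
        1# * 1#   ≈⟨ *-identityʳ 1# ⟩
        1#        ∎)

    0≤F : ∀ ts S → 0# ≤ F ts S
    0≤F []       S = 0≤1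
    0≤F (t ∷ ts) S = *-nonneg (0≤1-δx (0≤X t S) (X≤1 t S)) (0≤F ts S)

    F-anti : ∀ ts A S → F ts (S ⊕* A) ≤ F ts S
    F-anti []       A S = ≤-refl
    F-anti (t ∷ ts) A S = *-mono-≤ (0≤1-δx (0≤X t (S ⊕* A)) (X≤1 t (S ⊕* A))) (0≤F ts S)
      (+-monoʳ-≤ 1# (neg-mono-≤ (*-monoʳ-≤ 0≤δ (X-⊕*-mono A t S)))) (F-anti ts A S)

    private
      -- One triple in the induction for `F-⊕*`: x and x′ are its indicator before and after the
      -- addition, g and g′ the products over the other triples. If x = 0, the new factor loses
      -- δx′g′, at most δρg. If x = 1, the factor cannot shrink further, as x′ ≤ 1, and the ρ term
      -- is dropped.
      factor-bound : ∀ {x x′ ρ σ g g′} → x ≈ 0# ⊎ x ≈ 1# → x′ ≤ 1# → x′ ≤ x + ρ → 0# ≤ ρ →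
        0# ≤ g → 0# ≤ g′ → g′ ≤ g → g - δ * (σ * g) ≤ g′ →
        (1# - δ * x) * g - δ * ((ρ + σ) * ((1# - δ * x) * g)) ≤ (1# - δ * x′) * g′
      factor-bound {x} {x′} {ρ} {σ} {g} {g′} (inj₁ x≈0) x′≤1 x′≤x+ρ 0≤ρ 0≤g 0≤g′ g′≤g ih = begin
        (1# - δ * x) * g - δ * ((ρ + σ) * ((1# - δ * x) * g))
          ≈⟨ +-cong (*-congʳ eq) (-‿cong (*-congˡ (*-congˡ (*-congʳ eq)))) ⟩
        1# * g - δ * ((ρ + σ) * (1# * g))
          ≈⟨ solve 4 (λ δ ρ σ g → ⟪ 1 ⟫ :* g :- δ :* ((ρ :+ σ) :* (⟪ 1 ⟫ :* g))
               := (g :- δ :* (σ :* g)) :- δ :* (ρ :* g)) refl δ ρ σ g ⟩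
        (g - δ * (σ * g)) - δ * (ρ * g)
          ≤⟨ +-mono-≤ ih (neg-mono-≤ (*-monoʳ-≤ 0≤δ (*-mono-≤′ x′≤ρ))) ⟩
        g′ - δ * (x′ * g′)
          ≈⟨ solve 3 (λ δ x g → g :- δ :* (x :* g) := (⟪ 1 ⟫ :- δ :* x) :* g) refl δ x′ g′ ⟩
        (1# - δ * x′) * g′
          ∎
        where
        eq : 1# - δ * x ≈ 1#
        eq = trans (+-congˡ (-‿cong (trans (*-congˡ x≈0) (zeroʳ δ)))) (solve 0 (⟪ 1 ⟫ :- ⟪ 0 ⟫ := ⟪ 1 ⟫) refl)
        x′≤ρ : x′ ≤ ρ
        x′≤ρ = ≤-trans x′≤x+ρ (≤-reflexive (trans (+-congʳ x≈0) (+-identityˡ ρ)))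
        *-mono-≤′ : x′ ≤ ρ → x′ * g′ ≤ ρ * g
        *-mono-≤′ x′≤ρ = ≤-trans (*-monoˡ-≤ 0≤g′ x′≤ρ) (*-monoʳ-≤ 0≤ρ g′≤g)
      factor-bound {x} {x′} {ρ} {σ} {g} {g′} (inj₂ x≈1) x′≤1 x′≤x+ρ 0≤ρ 0≤g 0≤g′ g′≤g ih = begin
        (1# - δ * x) * g - δ * ((ρ + σ) * ((1# - δ * x) * g))
          ≈⟨ solve 5 (λ y δ ρ σ g → y :* g :- δ :* ((ρ :+ σ) :* (y :* g))
               := y :* (g :- δ :* (σ :* g)) :- δ :* (ρ :* (y :* g))) refl (1# - δ * x) δ ρ σ g ⟩
        (1# - δ * x) * (g - δ * (σ * g)) - δ * (ρ * ((1# - δ * x) * g))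
          ≤⟨ +-mono-≤ (*-monoʳ-≤ 0≤1-δx′ ih) (neg-mono-≤ (*-nonneg 0≤δ (*-nonneg 0≤ρ (*-nonneg 0≤1-δx′ 0≤g)))) ⟩
        (1# - δ * x) * g′ - 0#
          ≈⟨ solve 2 (λ y g → y :* g :- ⟪ 0 ⟫ := y :* g) refl (1# - δ * x) g′ ⟩
        (1# - δ * x) * g′
          ≤⟨ *-monoˡ-≤ 0≤g′ (+-monoʳ-≤ 1# (neg-mono-≤ (*-monoʳ-≤ 0≤δ (≤-trans x′≤1 (≤-reflexive (sym x≈1)))))) ⟩
        (1# - δ * x′) * g′
          ∎
        where
        0≤1-δx′ : 0# ≤ 1# - δ * x
        0≤1-δx′ = 0≤1-δx (≤-trans 0≤1 (≤-reflexive (sym x≈1))) (≤-reflexive x≈1)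

    -- Bernoulli's inequality (1 - δ)^r ≥ 1 - δr for the r triples newly completed. Its linearity in
    -- `R` is what lets `E-∑R*` evaluate the loss in the mean.
    F-⊕* : ∀ ts A S → F ts S - δ * ((∑[ t ∈ ts ] R A t S) * F ts S) ≤ F ts (S ⊕* A)
    F-⊕* []       A S = ≤-reflexive (solve 1 (λ δ → ⟪ 1 ⟫ :- δ :* (⟪ 0 ⟫ :* ⟪ 1 ⟫) := ⟪ 1 ⟫) refl δ)
    F-⊕* (t ∷ ts) A S = factor-bound (X≈0⊎X≈1 t S) (X≤1 t (S ⊕* A)) (X-⊕*-≤ A t S) (0≤R A t S)
      (0≤F ts S) (0≤F ts (S ⊕* A)) (F-anti ts A S) (F-⊕* ts A S)

    E-F : ∀ {Q} ts → Bounded Q 3 ts → E m (F ts) ≤ exp (- (δ * p ^ 3 * (1# - δ * Q))) ^ length ts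
    E-F     []       bounded = ≤-reflexive (E-const m 1#)
    E-F {Q} (t ∷ ts) bounded = begin
      E m (λ S → (1# - δ * X t S) * F ts S)
        ≈⟨ E-cong m (λ S → solve 3 (λ δ x f → (⟪ 1 ⟫ :- δ :* x) :* f := f :+ (:- δ) :* (x :* f)) refl δ (X t S) (F ts S)) ⟩
      E m (λ S → F ts S + - δ * (X t S * F ts S))
        ≈⟨ trans (E-+ m _ _) (+-congˡ (E-* m (- δ) _)) ⟩
      E m (F ts) + - δ * E m (λ S → X t S * F ts S)
        ≤⟨ +-monoʳ-≤ _ (≤-trans (≤-reflexive -δ*≈) (neg-mono-≤ (*-monoʳ-≤ 0≤δ E-XF))) ⟩
      E m (F ts) - δ * (p ^ 3 * (E m (F ts) - δ * (Q * E m (F ts))))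
        ≈⟨ solve 4 (λ f δ p³ Q → f :- δ :* (p³ :* (f :- δ :* (Q :* f)))
             := (⟪ 1 ⟫ :- δ :* p³ :* (⟪ 1 ⟫ :- δ :* Q)) :* f) refl (E m (F ts)) δ (p ^ 3) Q ⟩
      (1# - δ * p ^ 3 * (1# - δ * Q)) * E m (F ts)
        ≤⟨ *-monoˡ-≤ (E-nonneg m (0≤F ts)) (1+x≤exp _) ⟩
      exp (- (δ * p ^ 3 * (1# - δ * Q))) * E m (F ts)
        ≤⟨ *-monoʳ-≤ (exp-nonneg _) (E-F ts bounded-tail) ⟩
      exp (- (δ * p ^ 3 * (1# - δ * Q))) ^ suc (length ts)
        ∎
      where
      bounded-tail : Bounded Q 3 ts
      bounded-tail A ∣A∣≤3 = ≤-trans (≤-trans (≤-reflexive (sym (+-identityˡ _))) (+-monoˡ-≤ _ (0≤r A t))) (bounded A ∣A∣≤3)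

      A : List (Fin m)
      A = e₃ t ∷ e₂ t ∷ e₁ t ∷ []

      -δ*≈ : - δ * E m (λ S → X t S * F ts S) ≈ - (δ * E m (λ S → X t S * F ts S))
      -δ*≈ = solve 2 (λ δ x → :- δ :* x := :- (δ :* x)) refl δ _

      E-XF : p ^ 3 * (E m (F ts) - δ * (Q * E m (F ts))) ≤ E m (λ S → X t S * F ts S)
      E-XF = begin
        p ^ 3 * (E m (F ts) - δ * (Q * E m (F ts)))
          -- Added edges can only decrease `F ts`, so `E-∑R*` applies with the mean of `F ts` itself
          -- as the constant `C`.
          ≤⟨ *-monoʳ-≤ (^-nonneg 3 0≤p) (+-monoʳ-≤ _ (neg-mono-≤ (*-monoʳ-≤ 0≤δ (≤-trans
               (E-∑R* (λ B _ → E-mono m (F-anti ts B)) A ts)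
               (*-monoˡ-≤ (E-nonneg m (0≤F ts)) (bounded-tail A ℕ.≤-refl)))))) ⟩
        p ^ 3 * (E m (F ts) - δ * E m (λ S → (∑[ t ∈ ts ] R A t S) * F ts S))
          ≈⟨ *-congˡ (+-congˡ (solve 2 (λ δ x → :- (δ :* x) := :- δ :* x) refl δ _)) ⟩
        p ^ 3 * (E m (F ts) + - δ * E m (λ S → (∑[ t ∈ ts ] R A t S) * F ts S))
          ≈⟨ *-congˡ (trans (E-+ m _ _) (+-congˡ (E-* m (- δ) _))) ⟨
        p ^ 3 * E m (λ S → F ts S + - δ * ((∑[ t ∈ ts ] R A t S) * F ts S))
          ≤⟨ *-monoʳ-≤ (^-nonneg 3 0≤p) (E-mono m λ S → ≤-trans
               (≤-reflexive (+-congˡ (solve 2 (λ δ x → :- δ :* x := :- (δ :* x)) refl δ _))) (F-⊕* ts A S)) ⟩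
        p ^ 3 * E m (λ S → F ts (S ⊕* A))
          ≈⟨ E-χχχ (e₁≢e₂ t) (e₁≢e₃ t) (e₂≢e₃ t) (F ts) ⟨
        E m (λ S → χ (e₁ t) S * (χ (e₂ t) S * (χ (e₃ t) S * F ts S)))
          ≈⟨ E-cong m (λ S → solve 4 (λ x y z w → x :* (y :* z) :* w := x :* (y :* (z :* w))) refl
               (χ (e₁ t) S) (χ (e₂ t) S) (χ (e₃ t) S) (F ts S)) ⟨
        E m (λ S → X t S * F ts S)
          ∎

-- Degrees and codegrees of a family of triples

module Sparsity {c ℓ₁ ℓ₂} (ℝ : Reals c ℓ₁ ℓ₂) (P : Probability ℝ) (m : ℕ) where

  open OrderedField ℝ
  open Probability P
  open FiniteSums ℝ
  open Expectation ℝ P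
  open Triple
  open Triples ℝ P m
  open ≤-Reasoning

  -- Each slot of a triple and each pair of slots is bounded separately; adding up the three bounds
  -- of either kind is the origin of the factor 3 in `bound`.
  record Sparse (D : Carrier) (ts : List (Triple m)) : Set (ℓ₁ ⊔ ℓ₂) where
    field
      0≤D      : 0# ≤ D
      degree₁  : ∀ e → ∑[ t ∈ ts ] [ e ≡ e₁ t ] ≤ D
      degree₂  : ∀ e → ∑[ t ∈ ts ] [ e ≡ e₂ t ] ≤ D
      degree₃  : ∀ e → ∑[ t ∈ ts ] [ e ≡ e₃ t ] ≤ D
      codegree₁₂ : ∀ e e′ → ∑[ t ∈ ts ] ([ e ≡ e₁ t ] * [ e′ ≡ e₂ t ]) ≤ 1#
      codegree₁₃ : ∀ e e′ → ∑[ t ∈ ts ] ([ e ≡ e₁ t ] * [ e′ ≡ e₃ t ]) ≤ 1#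
      codegree₂₃ : ∀ e e′ → ∑[ t ∈ ts ] ([ e ≡ e₂ t ] * [ e′ ≡ e₃ t ]) ≤ 1#

  ∑-mult : ∀ {D} A ts (f : Triple m → Fin m) → (∀ e → ∑[ t ∈ ts ] [ e ≡ f t ] ≤ D) →
    ∑[ t ∈ ts ] mult A (f t) ≤ fromℕ (length A) * D
  ∑-mult {D} A ts f degree = begin
    ∑[ t ∈ ts ] (∑[ e ∈ A ] [ e ≡ f t ])   ≈⟨ ∑-comm ts A (λ t e → [ e ≡ f t ]) ⟩
    ∑[ e ∈ A ] (∑[ t ∈ ts ] [ e ≡ f t ])   ≤⟨ ∑-mono A degree ⟩
    ∑[ e ∈ A ] D                           ≈⟨ ∑-const A D ⟩
    fromℕ (length A) * D                   ∎

  ∑-mult-mult : ∀ A ts (f g : Triple m → Fin m) → (∀ e e′ → ∑[ t ∈ ts ] ([ e ≡ f t ] * [ e′ ≡ g t ]) ≤ 1#) →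
    ∑[ t ∈ ts ] (mult A (f t) * mult A (g t)) ≤ fromℕ (length A) * fromℕ (length A)
  ∑-mult-mult A ts f g codegree = begin
    ∑[ t ∈ ts ] (mult A (f t) * mult A (g t))
      ≈⟨ ∑-cong ts (λ t → trans (sym (∑-*ʳ A (λ e → [ e ≡ f t ]) _)) (∑-cong A λ e → sym (∑-*ˡ A _ (λ e′ → [ e′ ≡ g t ])))) ⟩
    ∑[ t ∈ ts ] (∑[ e ∈ A ] (∑[ e′ ∈ A ] ([ e ≡ f t ] * [ e′ ≡ g t ])))
      ≈⟨ ∑-comm ts A (λ t e → ∑[ e′ ∈ A ] ([ e ≡ f t ] * [ e′ ≡ g t ])) ⟩
    ∑[ e ∈ A ] (∑[ t ∈ ts ] (∑[ e′ ∈ A ] ([ e ≡ f t ] * [ e′ ≡ g t ])))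
      ≈⟨ ∑-cong A (λ e → ∑-comm ts A (λ t e′ → [ e ≡ f t ] * [ e′ ≡ g t ])) ⟩
    ∑[ e ∈ A ] (∑[ e′ ∈ A ] (∑[ t ∈ ts ] ([ e ≡ f t ] * [ e′ ≡ g t ])))
      ≤⟨ ∑-mono A (λ e → ∑-mono A (codegree e)) ⟩
    ∑[ e ∈ A ] (∑[ e′ ∈ A ] 1#)
      ≈⟨ trans (∑-const A _) (*-congˡ (trans (∑-const A 1#) (*-identityʳ _))) ⟩
    fromℕ (length A) * fromℕ (length A)
      ∎

  bound : Carrier → ℕ → Carrier
  bound D n = fromℕ 3 * (p ^ 2 * D * fromℕ n + fromℕ n * fromℕ n)

  sparse⇒bounded : ∀ {D ts} → Sparse D ts → ∀ n → Bounded (bound D n) n ts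
  sparse⇒bounded {D} {ts} sparse n A ∣A∣≤n = begin
    ∑ ts (r A)
      ≈⟨ trans (∑-+ ts _ (pairs A)) (+-cong (trans (∑-*ˡ ts (p ^ 2) _)
           (*-congˡ (trans (∑-+ ts _ _) (+-congʳ (∑-+ ts _ _))))) (trans (∑-+ ts _ _) (+-congʳ (∑-+ ts _ _)))) ⟩
    p ^ 2 * ((∑[ t ∈ ts ] mult A (e₁ t)) + (∑[ t ∈ ts ] mult A (e₂ t)) + (∑[ t ∈ ts ] mult A (e₃ t)))
      + ((∑[ t ∈ ts ] (mult A (e₁ t) * mult A (e₂ t))) + (∑[ t ∈ ts ] (mult A (e₁ t) * mult A (e₃ t)))
          + (∑[ t ∈ ts ] (mult A (e₂ t) * mult A (e₃ t))))
      ≤⟨ +-mono-≤ (*-monoʳ-≤ (^-nonneg 2 0≤p) (+-mono-≤ (+-mono-≤ (∑-mult A ts e₁ degree₁)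
           (∑-mult A ts e₂ degree₂)) (∑-mult A ts e₃ degree₃)))
         (+-mono-≤ (+-mono-≤ (∑-mult-mult A ts e₁ e₂ codegree₁₂) (∑-mult-mult A ts e₁ e₃ codegree₁₃))
           (∑-mult-mult A ts e₂ e₃ codegree₂₃)) ⟩
    p ^ 2 * (a * D + a * D + a * D) + (a * a + a * a + a * a)
      ≈⟨ solve 3 (λ p² D a → p² :* (a :* D :+ a :* D :+ a :* D) :+ (a :* a :+ a :* a :+ a :* a)
           := ⟪ 3 ⟫ :* (p² :* D :* a :+ a :* a)) refl (p ^ 2) D a ⟩
    fromℕ 3 * (p ^ 2 * D * a + a * a)
      ≤⟨ *-monoʳ-≤ (0≤fromℕ 3) (+-mono-≤ (*-monoʳ-≤ (*-nonneg (^-nonneg 2 0≤p) 0≤D) a≤n)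
           (*-mono-≤ (0≤fromℕ (length A)) (0≤fromℕ n) a≤n a≤n)) ⟩
    bound D n
      ∎
    where
    open Sparse sparse
    a = fromℕ (length A)
    a≤n = fromℕ-mono-≤ ∣A∣≤n

-- The two tails

module Concentration {c ℓ₁ ℓ₂} (ℝ : Reals c ℓ₁ ℓ₂) (P : Probability ℝ) (m : ℕ) where

  open OrderedField ℝ
  open Probability P
  open CommutativeSemiringExp (CommutativeRing.commutativeSemiring commutativeRing) using (^-distrib-*)
  open Expectation ℝ P
  open Exponential ℝ
  open Triples ℝ P m
  open LowerTail ℝ P m
  open Sparsity ℝ P m
  open Coins ℝ p using (Pr)
  open ≤-Reasoning

  -- A deviation by the factor 1 + 4ρ thus gains exp (2ρ) per moment: one exp ρ makes up for Q ≤ ρμ,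
  -- the other is the decay.
  1≤[1+4ρ]exp[-2ρ] : ∀ {ρ} → 0# ≤ ρ → fromℕ 4 * ρ ≤ 1# → 1# ≤ (1# + fromℕ 4 * ρ) * exp (- (fromℕ 2 * ρ))
  1≤[1+4ρ]exp[-2ρ] {ρ} 0≤ρ 4ρ≤1 = begin
    1#
      ≈⟨ +-identityʳ 1# ⟨
    1# + 0#
      ≤⟨ +-monoʳ-≤ 1# (*-nonneg (*-nonneg (0≤fromℕ 2) 0≤ρ) (x≤y⇒0≤y-x 4ρ≤1)) ⟩
    1# + fromℕ 2 * ρ * (1# - fromℕ 4 * ρ)
      ≈⟨ solve 1 (λ ρ → ⟪ 1 ⟫ :+ ⟪ 2 ⟫ :* ρ :* (⟪ 1 ⟫ :- ⟪ 4 ⟫ :* ρ)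
           := (⟪ 1 ⟫ :+ ⟪ 4 ⟫ :* ρ) :* (⟪ 1 ⟫ :- ⟪ 2 ⟫ :* ρ)) refl ρ ⟩
    (1# + fromℕ 4 * ρ) * (1# - fromℕ 2 * ρ)
      ≤⟨ *-monoʳ-≤ (+-nonneg 0≤1 (*-nonneg (0≤fromℕ 4) 0≤ρ)) (1+x≤exp _) ⟩
    (1# + fromℕ 4 * ρ) * exp (- (fromℕ 2 * ρ))
      ∎

  -- Both sides are compared with 1 / (1 + s), using (1 + s)(1 - s + s²) = 1 + s³.
  exp-neg-≤ : ∀ {s} → 0# ≤ s → exp (- s) ≤ 1# - s + s * s
  exp-neg-≤ {s} 0≤s = *-cancelˡ-≤ 0<1+s (begin
    (1# + s) * exp (- s)            ≤⟨ *-monoˡ-≤ (exp-nonneg _) (1+x≤exp s) ⟩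
    exp s * exp (- s)               ≈⟨ trans (*-comm _ _) (exp-inverse s) ⟩
    1#                              ≈⟨ +-identityʳ 1# ⟨
    1# + 0#                         ≤⟨ +-monoʳ-≤ 1# (^-nonneg 3 0≤s) ⟩
    1# + s ^ 3                      ≈⟨ solve 1 (λ s → ⟪ 1 ⟫ :+ s :^ 3 := (⟪ 1 ⟫ :+ s) :* (⟪ 1 ⟫ :- s :+ s :* s)) refl s ⟩
    (1# + s) * (1# - s + s * s)     ∎)
    where
    0<1+s : 0# < 1# + s
    0<1+s = <-≤-trans 0<1 (≤-trans (≤-reflexive (sym (+-identityʳ 1#))) (+-monoʳ-≤ 1# 0≤s))

  -- The bounds of the two tails need bound D (3k) = 27k² + 9kp²D and
  -- bound D 3 = 27 + 9p²D; the hypothesis concentrated covers both.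

  module Tails {D} {ts : List (Triple m)} (sparse : Sparse D ts) {ρ : Carrier} (0<ρ : 0# < ρ) (4ρ≤1 : fromℕ 4 * ρ ≤ 1#)
    (k : ℕ) (1≤k : 1 ℕ.≤ k)
    (concentrated : fromℕ k * fromℕ k * (fromℕ 27 + fromℕ 9 * (p ^ 2 * D)) ≤ ρ * (p ^ 3 * fromℕ (length ts))) where

    open Sparse sparse using (0≤D)

    κ μ : Carrier
    κ = fromℕ k
    μ = p ^ 3 * fromℕ (length ts)

    0≤ρ : 0# ≤ ρ
    0≤ρ = <⇒≤ 0<ρ

    1≤κ : 1# ≤ κ
    1≤κ = ≤-trans (≤-reflexive (sym (+-identityʳ 1#))) (fromℕ-mono-≤ 1≤k)

    0≤κ : 0# ≤ κ
    0≤κ = 0≤fromℕ k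

    0≤p²D : 0# ≤ p ^ 2 * D
    0≤p²D = *-nonneg (^-nonneg 2 0≤p) 0≤D

    κ≤κ² : κ ≤ κ * κ
    κ≤κ² = ≤-trans (≤-reflexive (sym (*-identityʳ κ))) (*-monoʳ-≤ 0≤κ 1≤κ)

    bound[3k]≤ρμ : bound D (3 ℕ.* k) ≤ ρ * μ
    bound[3k]≤ρμ = begin
      fromℕ 3 * (p ^ 2 * D * fromℕ (3 ℕ.* k) + fromℕ (3 ℕ.* k) * fromℕ (3 ℕ.* k))
        ≈⟨ *-congˡ (+-cong (*-congˡ (fromℕ-* 3 k)) (*-cong (fromℕ-* 3 k) (fromℕ-* 3 k))) ⟩
      fromℕ 3 * (p ^ 2 * D * (fromℕ 3 * κ) + (fromℕ 3 * κ) * (fromℕ 3 * κ))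
        ≈⟨ solve 2 (λ d κ → ⟪ 3 ⟫ :* (d :* (⟪ 3 ⟫ :* κ) :+ (⟪ 3 ⟫ :* κ) :* (⟪ 3 ⟫ :* κ))
             := κ :* κ :* ⟪ 27 ⟫ :+ κ :* (⟪ 9 ⟫ :* d)) refl (p ^ 2 * D) κ ⟩
      κ * κ * fromℕ 27 + κ * (fromℕ 9 * (p ^ 2 * D))
        ≤⟨ +-monoʳ-≤ _ (*-monoˡ-≤ (*-nonneg (0≤fromℕ 9) 0≤p²D) κ≤κ²) ⟩
      κ * κ * fromℕ 27 + κ * κ * (fromℕ 9 * (p ^ 2 * D))
        ≈⟨ distribˡ (κ * κ) _ _ ⟨
      κ * κ * (fromℕ 27 + fromℕ 9 * (p ^ 2 * D))
        ≤⟨ concentrated ⟩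
      ρ * μ
        ∎

    -- The left side, multiplied by s, is the second-order loss in the exponent of the lower tail:
    -- the 1 stems from s - s² ≤ δ, and `bound D 3` from the forced edges.
    k[1+bound[3]]≤2ρμ : κ * (1# + bound D 3) ≤ fromℕ 2 * (ρ * μ)
    k[1+bound[3]]≤2ρμ = begin
      κ * (1# + fromℕ 3 * (p ^ 2 * D * fromℕ 3 + fromℕ 3 * fromℕ 3))
        ≤⟨ *-monoʳ-≤ 0≤κ (+-monoˡ-≤ _ 1≤) ⟩
      κ * ((fromℕ 27 + fromℕ 9 * (p ^ 2 * D)) + fromℕ 3 * (p ^ 2 * D * fromℕ 3 + fromℕ 3 * fromℕ 3))
        ≈⟨ solve 2 (λ κ d → κ :* ((⟪ 27 ⟫ :+ ⟪ 9 ⟫ :* d) :+ ⟪ 3 ⟫ :* (d :* ⟪ 3 ⟫ :+ ⟪ 3 ⟫ :* ⟪ 3 ⟫))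
             := ⟪ 2 ⟫ :* (κ :* (⟪ 27 ⟫ :+ ⟪ 9 ⟫ :* d))) refl κ (p ^ 2 * D) ⟩
      fromℕ 2 * (κ * (fromℕ 27 + fromℕ 9 * (p ^ 2 * D)))
        ≤⟨ *-monoʳ-≤ (0≤fromℕ 2) (≤-trans (*-monoˡ-≤ 0≤27+ κ≤κ²) concentrated) ⟩
      fromℕ 2 * (ρ * μ)
        ∎
      where
      0≤27+ : 0# ≤ fromℕ 27 + fromℕ 9 * (p ^ 2 * D)
      0≤27+ = +-nonneg (0≤fromℕ 27) (*-nonneg (0≤fromℕ 9) 0≤p²D)
      1≤ : 1# ≤ fromℕ 27 + fromℕ 9 * (p ^ 2 * D)
      1≤ = begin
        1#               ≈⟨ +-identityʳ 1# ⟨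
        fromℕ 1          ≤⟨ fromℕ-mono-≤ {1} {27} (ℕ.s≤s ℕ.z≤n) ⟩
        fromℕ 27         ≈⟨ +-identityʳ _ ⟨
        fromℕ 27 + 0#    ≤⟨ +-monoʳ-≤ _ (*-nonneg (0≤fromℕ 9) 0≤p²D) ⟩
        fromℕ 27 + fromℕ 9 * (p ^ 2 * D) ∎

    -- The left side of `concentrated` is positive, which forces ρμ, and hence μ, to be positive.
    0<μ : 0# < μ
    0<μ = <-respʳ-≈ eq (*-pos (0<⁻¹ 0<ρ) 0<ρμ)
      where
      0<ρμ : 0# < ρ * μ
      0<ρμ = <-≤-trans (*-pos (*-pos 0<κ 0<κ) (<-≤-trans (0<1+n 26) (≤-trans (≤-reflexive (sym (+-identityʳ _)))
        (+-monoʳ-≤ _ (*-nonneg (0≤fromℕ 9) 0≤p²D))))) concentrated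
        where 0<κ = <-≤-trans 0<1 1≤κ
      eq : ρ ⁻¹⟨ 0<ρ ⟩ * (ρ * μ) ≈ μ
      eq = trans (solve 3 (λ i ρ μ → i :* (ρ :* μ) := (ρ :* i) :* μ) refl _ ρ μ)
        (trans (*-congʳ (*-inverseʳ 0<ρ)) (*-identityˡ μ))

    0≤μ : 0# ≤ μ
    0≤μ = <⇒≤ 0<μ

    v : Carrier
    v = μ ⁻¹⟨ 0<μ ⟩

    0≤v : 0# ≤ v
    0≤v = <⇒≤ (0<⁻¹ 0<μ)

    μv≈1 : μ * v ≈ 1#
    μv≈1 = *-inverseʳ 0<μ

    -- The scale at which T w ≥ 1 once T ≥ (1 + 4ρ) μ, while w (μ + Q) ≤ exp (- ρ).
    w : Carrier
    w = v * exp (- (fromℕ 2 * ρ))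

    0≤w : 0# ≤ w
    0≤w = *-nonneg 0≤v (exp-nonneg _)

    upper : Subset m → Carrier
    upper S = (T ts S * w) ^ k

    0≤upper : ∀ S → 0# ≤ upper S
    0≤upper S = ^-nonneg k (*-nonneg (0≤T ts S) 0≤w)

    1≤upper : ∀ S → μ + fromℕ 4 * ρ * μ ≤ T ts S → 1# ≤ upper S
    1≤upper S large = 1≤x⇒1≤x^n k (begin
      1#                                              ≤⟨ 1≤[1+4ρ]exp[-2ρ] 0≤ρ 4ρ≤1 ⟩
      (1# + fromℕ 4 * ρ) * x                          ≈⟨ *-identityˡ _ ⟨
      1# * ((1# + fromℕ 4 * ρ) * x)                   ≈⟨ *-congʳ μv≈1 ⟨
      μ * v * ((1# + fromℕ 4 * ρ) * x)                ≈⟨ solve 4 (λ μ v ρ x → μ :* v :* ((⟪ 1 ⟫ :+ ⟪ 4 ⟫ :* ρ) :* x)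
                                                           := (μ :+ ⟪ 4 ⟫ :* ρ :* μ) :* (v :* x)) refl μ v ρ x ⟩
      (μ + fromℕ 4 * ρ * μ) * w                       ≤⟨ *-monoˡ-≤ 0≤w large ⟩
      T ts S * w                                      ∎)
      where x = exp (- (fromℕ 2 * ρ))

    E-upper : E m upper ≤ exp (- (ρ * κ))
    E-upper = begin
      E m (λ S → (T ts S * w) ^ k)
        ≈⟨ trans (E-cong m λ S → trans (^-distrib-* (T ts S) w k) (*-comm _ _)) (E-* m (w ^ k) _) ⟩
      w ^ k * E m (λ S → T ts S ^ k)
        ≤⟨ *-monoʳ-≤ (^-nonneg k 0≤w) (moment ts (sparse⇒bounded sparse (3 ℕ.* k)) k [] ℕ.≤-refl) ⟩
      w ^ k * M ^ k
        ≈⟨ ^-distrib-* w M k ⟨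
      (w * M) ^ k
        ≤⟨ ^-mono-≤ k (*-nonneg 0≤w 0≤M) wM≤ ⟩
      exp (- ρ) ^ k
        ≈⟨ exp-^ k (- ρ) ⟩
      exp (κ * - ρ)
        ≈⟨ exp-cong (solve 2 (λ κ ρ → κ :* :- ρ := :- (ρ :* κ)) refl κ ρ) ⟩
      exp (- (ρ * κ))
        ∎
      where
      M = μ + bound D (3 ℕ.* k)
      0≤M : 0# ≤ M
      0≤M = +-nonneg 0≤μ (*-nonneg (0≤fromℕ 3) (+-nonneg (*-nonneg 0≤p²D (0≤fromℕ (3 ℕ.* k)))
        (*-nonneg (0≤fromℕ (3 ℕ.* k)) (0≤fromℕ (3 ℕ.* k)))))
      x = exp (- (fromℕ 2 * ρ))
      wM≤ : w * M ≤ exp (- ρ)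
      wM≤ = begin
        w * M                     ≤⟨ *-monoʳ-≤ 0≤w (+-monoʳ-≤ μ bound[3k]≤ρμ) ⟩
        v * x * (μ + ρ * μ)       ≈⟨ solve 4 (λ v x μ ρ → v :* x :* (μ :+ ρ :* μ) := (μ :* v) :* (x :* (⟪ 1 ⟫ :+ ρ))) refl v x μ ρ ⟩
        μ * v * (x * (1# + ρ))    ≈⟨ trans (*-congʳ μv≈1) (*-identityˡ _) ⟩
        x * (1# + ρ)              ≤⟨ *-monoʳ-≤ (exp-nonneg _) (1+x≤exp ρ) ⟩
        x * exp ρ                 ≈⟨ exp-+ _ ρ ⟨
        exp (- (fromℕ 2 * ρ) + ρ) ≈⟨ exp-cong (solve 1 (λ ρ → :- (⟪ 2 ⟫ :* ρ) :+ ρ := :- ρ) refl ρ) ⟩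
        exp (- ρ)                 ∎

    -- The exponent with s μ = k, for which exp (- s T) is the power (1 - δ) ^ T.

    s : Carrier
    s = κ * v

    δ : Carrier
    δ = 1# - exp (- s)

    0≤s : 0# ≤ s
    0≤s = *-nonneg 0≤κ 0≤v

    sμ≈κ : s * μ ≈ κ
    sμ≈κ = trans (solve 3 (λ κ v μ → κ :* v :* μ := κ :* (μ :* v)) refl κ v μ) (trans (*-congˡ μv≈1) (*-identityʳ κ))

    0≤δ : 0# ≤ δ
    0≤δ = x≤y⇒0≤y-x (≤-trans (exp-mono-≤ (≤-trans (neg-mono-≤ 0≤s)
      (≤-reflexive (solve 0 (:- ⟪ 0 ⟫ := ⟪ 0 ⟫) refl)))) (≤-reflexive exp-0))

    δ≤1 : δ ≤ 1#
    δ≤1 = ≤-trans (+-monoʳ-≤ 1# (neg-mono-≤ (exp-nonneg (- s)))) (≤-reflexive (solve 0 (⟪ 1 ⟫ :- ⟪ 0 ⟫ := ⟪ 1 ⟫) refl))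

    δ≤s : δ ≤ s
    δ≤s = begin
      1# - exp (- s)     ≤⟨ +-monoʳ-≤ 1# (neg-mono-≤ (1+x≤exp (- s))) ⟩
      1# - (1# - s)      ≈⟨ solve 1 (λ s → ⟪ 1 ⟫ :- (⟪ 1 ⟫ :- s) := s) refl s ⟩
      s                  ∎

    s-s²≤δ : s - s * s ≤ δ
    s-s²≤δ = begin
      s - s * s                ≈⟨ solve 1 (λ s → s :- s :* s := ⟪ 1 ⟫ :- (⟪ 1 ⟫ :- s :+ s :* s)) refl s ⟩
      1# - (1# - s + s * s)    ≤⟨ +-monoʳ-≤ 1# (neg-mono-≤ (exp-neg-≤ 0≤s)) ⟩
      δ                        ∎

    F≈exp : ∀ ts S → F 0≤δ δ≤1 ts S ≈ exp (- (s * T ts S))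
    F≈exp []       S = sym (trans (exp-cong (solve 1 (λ s → :- (s :* ⟪ 0 ⟫) := ⟪ 0 ⟫) refl s)) exp-0)
    F≈exp (t ∷ ts) S = begin-equality
      (1# - δ * X t S) * F 0≤δ δ≤1 ts S           ≈⟨ *-cong (factor (X≈0⊎X≈1 t S)) (F≈exp ts S) ⟩
      exp (- (s * X t S)) * exp (- (s * T ts S))  ≈⟨ exp-+ _ _ ⟨
      exp (- (s * X t S) + - (s * T ts S))        ≈⟨ exp-cong (solve 3 (λ s x y → :- (s :* x) :+ :- (s :* y) := :- (s :* (x :+ y))) refl s _ _) ⟩
      exp (- (s * T (t ∷ ts) S))                  ∎
      where
      factor : ∀ {x} → x ≈ 0# ⊎ x ≈ 1# → 1# - δ * x ≈ exp (- (s * x))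
      factor {x} (inj₁ x≈0) = begin-equality
        1# - δ * x        ≈⟨ +-congˡ (-‿cong (*-congˡ x≈0)) ⟩
        1# - δ * 0#       ≈⟨ solve 1 (λ δ → ⟪ 1 ⟫ :- δ :* ⟪ 0 ⟫ := ⟪ 1 ⟫) refl δ ⟩
        1#                ≈⟨ exp-0 ⟨
        exp 0#            ≈⟨ exp-cong (trans (solve 1 (λ s → ⟪ 0 ⟫ := :- (s :* ⟪ 0 ⟫)) refl s) (-‿cong (*-congˡ (sym x≈0)))) ⟩
        exp (- (s * x))   ∎
      factor {x} (inj₂ x≈1) = begin-equality
        1# - δ * x        ≈⟨ +-congˡ (-‿cong (*-congˡ x≈1)) ⟩
        1# - δ * 1#       ≈⟨ solve 1 (λ e → ⟪ 1 ⟫ :- (⟪ 1 ⟫ :- e) :* ⟪ 1 ⟫ := e) refl (exp (- s)) ⟩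
        exp (- s)         ≈⟨ exp-cong (-‿cong (trans (sym (*-identityʳ s)) (*-congˡ (sym x≈1)))) ⟩
        exp (- (s * x))   ∎

    -- The Chernoff weight exp (s ((1 - 4ρ) μ - T)), with its random part written as `F`.
    lower : Subset m → Carrier
    lower S = exp (s * (μ - fromℕ 4 * ρ * μ)) * F 0≤δ δ≤1 ts S

    0≤lower : ∀ S → 0# ≤ lower S
    0≤lower S = *-nonneg (exp-nonneg _) (0≤F 0≤δ δ≤1 ts S)

    1≤lower : ∀ S → T ts S ≤ μ - fromℕ 4 * ρ * μ → 1# ≤ lower S
    1≤lower S small = begin
      1#
        ≈⟨ exp-0 ⟨
      exp 0#
        ≤⟨ exp-mono-≤ (*-nonneg 0≤s (x≤y⇒0≤y-x small)) ⟩
      exp (s * ((μ - fromℕ 4 * ρ * μ) - T ts S))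
        ≈⟨ exp-cong (solve 3 (λ s a t → s :* (a :- t) := s :* a :+ :- (s :* t)) refl s _ _) ⟩
      exp (s * (μ - fromℕ 4 * ρ * μ) + - (s * T ts S))
        ≈⟨ exp-+ _ _ ⟩
      exp (s * (μ - fromℕ 4 * ρ * μ)) * exp (- (s * T ts S))
        ≈⟨ *-congˡ (F≈exp ts S) ⟨
      lower S
        ∎

    E-lower : E m lower ≤ exp (- (ρ * κ))
    E-lower = begin
      E m lower
        ≈⟨ E-* m _ (F 0≤δ δ≤1 ts) ⟩
      x * E m (F 0≤δ δ≤1 ts)
        ≤⟨ *-monoʳ-≤ (exp-nonneg _) (E-F 0≤δ δ≤1 ts (sparse⇒bounded sparse 3)) ⟩
      x * exp (- (δ * p ^ 3 * (1# - δ * Q))) ^ length ts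
        ≈⟨ *-congˡ (exp-^ (length ts) _) ⟩
      x * exp (fromℕ (length ts) * - (δ * p ^ 3 * (1# - δ * Q)))
        ≈⟨ exp-+ _ _ ⟨
      exp (s * (μ - fromℕ 4 * ρ * μ) + fromℕ (length ts) * - (δ * p ^ 3 * (1# - δ * Q)))
        ≤⟨ exp-mono-≤ exponent ⟩
      exp (- (ρ * κ))
        ∎
      where
      Q = bound D 3
      x = exp (s * (μ - fromℕ 4 * ρ * μ))
      0≤Q : 0# ≤ Q
      0≤Q = *-nonneg (0≤fromℕ 3) (+-nonneg (*-nonneg 0≤p²D (0≤fromℕ 3)) (*-nonneg (0≤fromℕ 3) (0≤fromℕ 3)))
      exponent : s * (μ - fromℕ 4 * ρ * μ) + fromℕ (length ts) * - (δ * p ^ 3 * (1# - δ * Q)) ≤ - (ρ * κ)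
      exponent = begin
        s * (μ - fromℕ 4 * ρ * μ) + fromℕ (length ts) * - (δ * p ^ 3 * (1# - δ * Q))
          ≈⟨ solve 6 (λ s p³ l δ Q ρ → s :* (p³ :* l :- ⟪ 4 ⟫ :* ρ :* (p³ :* l)) :+ l :* :- (δ :* p³ :* (⟪ 1 ⟫ :- δ :* Q))
               := s :* (p³ :* l :- ⟪ 4 ⟫ :* ρ :* (p³ :* l)) :+ (δ :* δ :* ((p³ :* l) :* Q) :- δ :* (p³ :* l)))
               refl s (p ^ 3) (fromℕ (length ts)) δ Q ρ ⟩
        s * (μ - fromℕ 4 * ρ * μ) + (δ * δ * (μ * Q) - δ * μ)
          -- The two occurrences of δ need opposite bounds: δ ≤ s in the quadratic term, δ ≥ s - s²
          -- in the linear one.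
          ≤⟨ +-monoʳ-≤ _ (+-mono-≤ (*-monoˡ-≤ (*-nonneg 0≤μ 0≤Q) (*-mono-≤ 0≤δ 0≤s δ≤s δ≤s))
               (neg-mono-≤ (*-monoˡ-≤ 0≤μ s-s²≤δ))) ⟩
        s * (μ - fromℕ 4 * ρ * μ) + (s * s * (μ * Q) - (s - s * s) * μ)
          ≈⟨ solve 4 (λ s μ Q ρ → s :* (μ :- ⟪ 4 ⟫ :* ρ :* μ) :+ (s :* s :* (μ :* Q) :- (s :- s :* s) :* μ)
               := s :* (s :* μ :* (⟪ 1 ⟫ :+ Q)) :- ⟪ 4 ⟫ :* ρ :* (s :* μ)) refl s μ Q ρ ⟩
        s * (s * μ * (1# + Q)) - fromℕ 4 * ρ * (s * μ)
          ≈⟨ +-cong (*-congˡ (*-congʳ sμ≈κ)) (-‿cong (*-congˡ sμ≈κ)) ⟩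
        s * (κ * (1# + Q)) - fromℕ 4 * ρ * κ
          ≤⟨ +-monoˡ-≤ _ (*-monoʳ-≤ 0≤s k[1+bound[3]]≤2ρμ) ⟩
        s * (fromℕ 2 * (ρ * μ)) - fromℕ 4 * ρ * κ
          ≈⟨ +-congʳ (trans (solve 3 (λ s ρ μ → s :* (⟪ 2 ⟫ :* (ρ :* μ)) := ⟪ 2 ⟫ :* ρ :* (s :* μ)) refl s ρ μ) (*-congˡ sμ≈κ)) ⟩
        fromℕ 2 * ρ * κ - fromℕ 4 * ρ * κ
          ≈⟨ solve 2 (λ ρ κ → ⟪ 2 ⟫ :* ρ :* κ :- ⟪ 4 ⟫ :* ρ :* κ := :- (ρ :* κ) :- ρ :* κ) refl ρ κ ⟩
        - (ρ * κ) - ρ * κ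
          -- Half of the gain 2ρκ is given away, so that both tails share one bound.
          ≤⟨ +-monoʳ-≤ _ (neg-mono-≤ (*-nonneg 0≤ρ 0≤κ)) ⟩
        - (ρ * κ) - 0#
          ≈⟨ solve 1 (λ x → x :- ⟪ 0 ⟫ := x) refl (- (ρ * κ)) ⟩
        - (ρ * κ)
          ∎

    concentration : ∀ {ε ℓ} {P : Pred (Subset m) ℓ} (P? : Decidable P) → fromℕ 4 * ρ ≤ ε →
      (∀ S → P S → ε * μ ≤ abs (T ts S - μ)) → Pr m P? ≤ fromℕ 2 * exp (- (ρ * κ))
    concentration {ε} {P = P} P? 4ρ≤ε deviates = begin
      Pr m P?
        -- Markov's inequality for the sum replaces a union bound, which would have to decide the
        -- tail in which `S` lies.
        ≤⟨ markov P? (λ S → upper S + lower S) (λ S → +-nonneg (0≤upper S) (0≤lower S)) 1≤tails ⟩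
      E m (λ S → upper S + lower S)
        ≈⟨ E-+ m upper lower ⟩
      E m upper + E m lower
        ≤⟨ +-mono-≤ E-upper E-lower ⟩
      exp (- (ρ * κ)) + exp (- (ρ * κ))
        ≈⟨ solve 1 (λ x → x :+ x := ⟪ 2 ⟫ :* x) refl _ ⟩
      fromℕ 2 * exp (- (ρ * κ))
        ∎
      where
      4ρμ≤ : ∀ S → P S → fromℕ 4 * ρ * μ ≤ abs (T ts S - μ)
      4ρμ≤ S PS = ≤-trans (*-monoˡ-≤ 0≤μ 4ρ≤ε) (deviates S PS)

      1≤tails : ∀ S → P S → 1# ≤ upper S + lower S
      1≤tails S PS = ≤-cases 0# (T ts S - μ) above below
        where
        above : 0# ≤ T ts S - μ → 1# ≤ upper S + lower S
        above 0≤T-μ = begin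
          1#                 ≤⟨ 1≤upper S (≤-trans (+-monoʳ-≤ μ (≤-trans (4ρμ≤ S PS) (≤-reflexive (0≤x⇒abs≈x 0≤T-μ))))
                                  (≤-reflexive (solve 2 (λ μ t → μ :+ (t :- μ) := t) refl μ _))) ⟩
          upper S            ≈⟨ +-identityʳ _ ⟨
          upper S + 0#       ≤⟨ +-monoʳ-≤ _ (0≤lower S) ⟩
          upper S + lower S  ∎
        below : T ts S - μ ≤ 0# → 1# ≤ upper S + lower S
        below T-μ≤0 = begin
          1#                 ≤⟨ 1≤lower S (≤-trans (≤-reflexive (solve 2 (λ μ t → t := μ :+ :- (:- (t :- μ))) refl μ _))
                                  (+-monoʳ-≤ μ (neg-mono-≤ (≤-trans (4ρμ≤ S PS) (≤-reflexive (x≤0⇒abs≈- T-μ≤0)))))) ⟩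
          lower S            ≈⟨ +-identityˡ _ ⟨
          0# + lower S       ≤⟨ +-monoˡ-≤ _ (0≤upper S) ⟩
          upper S + lower S  ∎

-- Triangles of a graph as triples of edges

lookup-injective : ∀ {a} {A : Set a} {xs : List A} → Unique xs → ∀ {i j} →
  List.lookup xs i ≡ List.lookup xs j → i ≡ j
lookup-injective (x∉xs ∷ unique) {zero}  {zero}  eq = ≡.refl
lookup-injective (x∉xs ∷ unique) {zero}  {suc j} eq = contradiction eq (All.lookup x∉xs (∈-lookup j))
lookup-injective (x∉xs ∷ unique) {suc i} {zero}  eq = contradiction (≡.sym eq) (All.lookup x∉xs (∈-lookup i))
lookup-injective (x∉xs ∷ unique) {suc i} {suc j} eq = ≡.cong suc (lookup-injective unique eq)

module GraphTriangles {n : ℕ} (G : SimpleGraph n) where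
  open SimpleGraph G
  open Triple

  vertexPairs : List (Fin n × Fin n)
  vertexPairs = cartesianProduct (allFin n) (allFin n)

  vertexTriples : List (Fin n × Fin n × Fin n)
  vertexTriples = cartesianProduct (allFin n) vertexPairs

  pairs-unique : Unique vertexPairs
  pairs-unique = Unique.cartesianProduct⁺ (Unique.allFin⁺ n) (Unique.allFin⁺ n)

  triples-unique : Unique vertexTriples
  triples-unique = Unique.cartesianProduct⁺ (Unique.allFin⁺ n) pairs-unique

  edges-unique : Unique (edges G)
  edges-unique = Unique.filter⁺ (isEdge? G) pairs-unique

  private
    ∈-edges : ∀ {u v} → IsEdge G (u , v) → (u , v) List.∈ edges G
    ∈-edges {u} {v} = ∈-filter⁺ (isEdge? G) (∈-cartesianProduct⁺ (∈-allFin u) (∈-allFin v))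

  edgeIndex : ∀ {u v} → IsEdge G (u , v) → Fin (#edges G)
  edgeIndex uv = Any.index (∈-edges uv)

  lookup-edgeIndex : ∀ {u v} (uv : IsEdge G (u , v)) → List.lookup (edges G) (edgeIndex uv) ≡ (u , v)
  lookup-edgeIndex uv = ≡.sym (lookup-index (∈-edges uv))

  edgeIndex-injective : ∀ {u v u′ v′} (uv : IsEdge G (u , v)) (uv′ : IsEdge G (u′ , v′)) →
    edgeIndex uv ≡ edgeIndex uv′ → (u , v) ≡ (u′ , v′)
  edgeIndex-injective uv uv′ eq = ≡.trans (≡.sym (lookup-edgeIndex uv))
    (≡.trans (≡.cong (List.lookup (edges G)) eq) (lookup-edgeIndex uv′))

  lookup-isEdge : ∀ i → IsEdge G (List.lookup (edges G) i)
  lookup-isEdge i = proj₂ (∈-filter⁻ (isEdge? G) {xs = vertexPairs} (∈-lookup {xs = edges G} i))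

  -- Edges are listed with the smaller end first, which excludes the reversed pair.
  joins⇒lookup : ∀ {i u v} → u Fin.< v → Joins G i u v → List.lookup (edges G) i ≡ (u , v)
  joins⇒lookup             u<v (inj₁ eq) = eq
  joins⇒lookup {i} {u} {v} u<v (inj₂ eq) =
    contradiction (proj₁ (≡.subst (IsEdge G) eq (lookup-isEdge i))) (Fin.<-asym u<v)

  module _ (S : Subset (#edges G)) where
    open SimpleGraph (subgraph G S) using () renaming (_~_ to _~′_)

    subgraph-~⇒~ : ∀ {u v} → u Fin.< v → u ~′ v → u ~ v
    subgraph-~⇒~ u<v (i , _ , joins) = proj₂ (≡.subst (IsEdge G) (joins⇒lookup u<v joins) (lookup-isEdge i))

    -- Adjacency supplies some position in `S`; as no edge is listed twice, that position is
    -- `edgeIndex uv`.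
    subgraph-~⇒lookup : ∀ {u v} (uv : IsEdge G (u , v)) → u ~′ v → Vec.lookup S (edgeIndex uv) ≡ true
    subgraph-~⇒lookup uv@(u<v , _) (i , i∈S , joins) =
      ≡.subst (λ j → Vec.lookup S j ≡ true)
        (lookup-injective edges-unique (≡.trans (joins⇒lookup u<v joins) (≡.sym (lookup-edgeIndex uv))))
        ([]=⇒lookup i∈S)

    lookup⇒subgraph-~ : ∀ {u v} (uv : IsEdge G (u , v)) → Vec.lookup S (edgeIndex uv) ≡ true → u ~′ v
    lookup⇒subgraph-~ uv eq = edgeIndex uv , lookup⇒[]= (edgeIndex uv) S eq , inj₁ (lookup-edgeIndex uv)

  edgeTriple : ∀ {t} → IsTriangle G t → Triple (#edges G)
  edgeTriple {u , v , w} ((u<v , v<w) , (u~v , v~w , u~w)) = record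
    { e₁    = edgeIndex uv
    ; e₂    = edgeIndex vw
    ; e₃    = edgeIndex uw
    ; e₁≢e₂ = λ eq → Fin.<-irrefl (,-injectiveˡ (edgeIndex-injective uv vw eq)) u<v
    ; e₁≢e₃ = λ eq → Fin.<-irrefl (,-injectiveʳ (edgeIndex-injective uv uw eq)) v<w
    ; e₂≢e₃ = λ eq → Fin.<-irrefl (≡.sym (,-injectiveˡ (edgeIndex-injective vw uw eq))) u<v
    }
    where
    uv = u<v , u~v
    vw = v<w , v~w
    uw = Fin.<-trans u<v v<w , u~w

  -- Decision procedures are variables here, as the standard library's filter
  -- would otherwise unfold them.

  edgeTriples : Decidable (IsTriangle G) → List (Fin n × Fin n × Fin n) → List (Triple (#edges G))
  edgeTriples P? []       = []
  edgeTriples P? (t ∷ ts) with P? t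
  ... | yes tri = edgeTriple tri ∷ edgeTriples P? ts
  ... | no  _   = edgeTriples P? ts

  length-edgeTriples : ∀ P? ts → length (edgeTriples P? ts) ≡ length (filter P? ts)
  length-edgeTriples P? []       = ≡.refl
  length-edgeTriples P? (t ∷ ts) with P? t
  ... | yes _ = ≡.cong suc (length-edgeTriples P? ts)
  ... | no  _ = length-edgeTriples P? ts

  IsSide : (Triple (#edges G) → Fin (#edges G)) → Set
  IsSide f = ∀ {t} (tri : IsTriangle G t) → Contains G (List.lookup (edges G) (f (edgeTriple tri))) t

  -- The source of the codegree bound 1: two sides cover all three vertices, and the slots tell
  -- which vertex is which.
  Determine : (f g : Triple (#edges G) → Fin (#edges G)) → Set
  Determine f g = ∀ {t t′} (tri : IsTriangle G t) (tri′ : IsTriangle G t′) →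
    f (edgeTriple tri) ≡ f (edgeTriple tri′) → g (edgeTriple tri) ≡ g (edgeTriple tri′) → t ≡ t′

  e₁-isSide : IsSide e₁
  e₁-isSide {t} ((u<v , v<w) , (u~v , v~w , u~w)) =
    ≡.subst (λ e → Contains G e t) (≡.sym (lookup-edgeIndex (u<v , u~v))) (here ≡.refl , there (here ≡.refl))

  e₂-isSide : IsSide e₂
  e₂-isSide {t} ((u<v , v<w) , (u~v , v~w , u~w)) =
    ≡.subst (λ e → Contains G e t) (≡.sym (lookup-edgeIndex (v<w , v~w)))
      (there (here ≡.refl) , there (there (here ≡.refl)))

  e₃-isSide : IsSide e₃
  e₃-isSide {t} ((u<v , v<w) , (u~v , v~w , u~w)) =
    ≡.subst (λ e → Contains G e t) (≡.sym (lookup-edgeIndex (Fin.<-trans u<v v<w , u~w)))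
      (here ≡.refl , there (there (here ≡.refl)))

  e₁e₂-determine : Determine e₁ e₂
  e₁e₂-determine ((u<v , v<w) , (u~v , v~w , u~w)) ((u<v′ , v<w′) , (u~v′ , v~w′ , u~w′)) eq₁ eq₂ =
    ≡.cong₂ _,_ (,-injectiveˡ (edgeIndex-injective (u<v , u~v) (u<v′ , u~v′) eq₁))
      (edgeIndex-injective (v<w , v~w) (v<w′ , v~w′) eq₂)

  e₁e₃-determine : Determine e₁ e₃
  e₁e₃-determine ((u<v , v<w) , (u~v , v~w , u~w)) ((u<v′ , v<w′) , (u~v′ , v~w′ , u~w′)) eq₁ eq₃ =
    ≡.cong₂ _,_ (,-injectiveˡ uv≡) (≡.cong₂ _,_ (,-injectiveʳ uv≡)
      (,-injectiveʳ (edgeIndex-injective (Fin.<-trans u<v v<w , u~w) (Fin.<-trans u<v′ v<w′ , u~w′) eq₃)))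
    where uv≡ = edgeIndex-injective (u<v , u~v) (u<v′ , u~v′) eq₁

  e₂e₃-determine : Determine e₂ e₃
  e₂e₃-determine ((u<v , v<w) , (u~v , v~w , u~w)) ((u<v′ , v<w′) , (u~v′ , v~w′ , u~w′)) eq₂ eq₃ =
    ≡.cong₂ _,_ (,-injectiveˡ (edgeIndex-injective (Fin.<-trans u<v v<w , u~w) (Fin.<-trans u<v′ v<w′ , u~w′) eq₃))
      (edgeIndex-injective (v<w , v~w) (v<w′ , v~w′) eq₂)

-- The triangle count of the random subgraph, and sparsity of its triples

module TriangleCount {c ℓ₁ ℓ₂} (ℝ : Reals c ℓ₁ ℓ₂) (P : Probability ℝ) {n : ℕ} (G : SimpleGraph n) where

  open OrderedField ℝ
  open Probability P
  open FiniteSums ℝ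
  open Expectation ℝ P
  open Triples ℝ P (#edges G)
  open Sparsity ℝ P (#edges G) using (Sparse)
  open GraphTriangles G
  open Triple

  -- A triangle of the subgraph is a triangle of `G` whose three coins all succeed; a triangle of
  -- `G` that is lost has a failed coin and adds 0 on the right.
  T-edgeTriples : ∀ P? S (Q? : Decidable (IsTriangle (subgraph G S))) ts →
    fromℕ (length (filter Q? ts)) ≈ T (edgeTriples P? ts) S
  T-edgeTriples P? S Q? []       = refl
  T-edgeTriples P? S Q? (t ∷ ts) with Q? t | P? t
  ... | yes (_ , (u~v′ , v~w′ , u~w′)) | yes ((u<v , v<w) , (u~v , v~w , u~w)) =
    +-cong (sym (trans (*-cong (χ≈1 (u<v , u~v) u~v′) (trans (*-cong (χ≈1 (v<w , v~w) v~w′)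
      (χ≈1 (Fin.<-trans u<v v<w , u~w) u~w′)) (*-identityʳ 1#))) (*-identityʳ 1#))) (T-edgeTriples P? S Q? ts)
    where
    χ≈1 : ∀ {u v} (uv : IsEdge G (u , v)) → SimpleGraph._~_ (subgraph G S) u v → χ (edgeIndex uv) S ≈ 1#
    χ≈1 uv u~v′ = reflexive (≡.cong ι (subgraph-~⇒lookup S uv u~v′))
  ... | yes ((u<v , v<w) , (u~v′ , v~w′ , u~w′)) | no ¬tri =
    contradiction ((u<v , v<w) , subgraph-~⇒~ S u<v u~v′ , subgraph-~⇒~ S v<w v~w′ ,
      subgraph-~⇒~ S (Fin.<-trans u<v v<w) u~w′) ¬tri
  ... | no _ | no _ = T-edgeTriples P? S Q? ts
  ... | no ¬tri′ | yes tri@((u<v , v<w) , (u~v , v~w , u~w)) =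
    trans (sym (+-identityˡ _)) (+-cong (sym X≈0) (T-edgeTriples P? S Q? ts))
    where
    X≈0 : X (edgeTriple tri) S ≈ 0#
    X≈0 with Vec.lookup S (edgeIndex (u<v , u~v)) in eq₁ | Vec.lookup S (edgeIndex (v<w , v~w)) in eq₂
           | Vec.lookup S (edgeIndex (Fin.<-trans u<v v<w , u~w)) in eq₃
    ... | false | _     | _     = zeroˡ _
    ... | true  | false | _     = trans (*-congˡ (zeroˡ _)) (zeroʳ _)
    ... | true  | true  | false = trans (*-congˡ (zeroʳ _)) (zeroʳ _)
    ... | true  | true  | true  = contradiction ((u<v , v<w) , lookup⇒subgraph-~ S (u<v , u~v) eq₁ ,
      lookup⇒subgraph-~ S (v<w , v~w) eq₂ , lookup⇒subgraph-~ S (Fin.<-trans u<v v<w , u~w) eq₃) ¬tri′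

  degree-edgeTriples : ∀ {f} → IsSide f → ∀ P? e (Q? : Decidable (Contains G (List.lookup (edges G) e))) ts →
    ∑[ t ∈ edgeTriples P? ts ] [ e ≡ f t ] ≤ fromℕ (length (filter Q? (filter P? ts)))
  degree-edgeTriples         isSide P? e Q? []       = ≤-refl
  degree-edgeTriples {f = f} isSide P? e Q? (t ∷ ts) with P? t
  ... | no  _   = degree-edgeTriples isSide P? e Q? ts
  ... | yes tri with e Fin.≟ f (edgeTriple tri) | Q? t
  ...   | yes ≡.refl | yes _   = +-monoʳ-≤ 1# (degree-edgeTriples isSide P? e Q? ts)
  ...   | yes ≡.refl | no  e∉t = contradiction (isSide tri) e∉t
  -- The edge lies in `t` but in another slot, so `t` counts on the right only.
  ...   | no  _      | yes _   = +-mono-≤ 0≤1 (degree-edgeTriples isSide P? e Q? ts)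
  ...   | no  _      | no  _   = ≤-trans (≤-reflexive (+-identityˡ _)) (degree-edgeTriples isSide P? e Q? ts)

  -- Once a triple has matched both edges, another match would be the same triangle, which the list
  -- does not repeat.
  codegree-edgeTriples : ∀ {f g} → Determine f g → ∀ P? {ts} → Unique ts → ∀ e e′ →
    ∑[ t ∈ edgeTriples P? ts ] ([ e ≡ f t ] * [ e′ ≡ g t ]) ≤ 1#
  codegree-edgeTriples {f} {g} determine P? unique e e′ = atMostOne _ unique
    where
    none : ∀ {t} (tri : IsTriangle G t) → f (edgeTriple tri) ≡ e → g (edgeTriple tri) ≡ e′ →
      ∀ ts → All (t ≢_) ts → ∑[ t ∈ edgeTriples P? ts ] ([ e ≡ f t ] * [ e′ ≡ g t ]) ≤ 0#
    none tri eq eq′ []        []             = ≤-refl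
    none tri eq eq′ (t′ ∷ ts) (t≢t′ ∷ t∉ts) with P? t′
    ... | no  _    = none tri eq eq′ ts t∉ts
    ... | yes tri′ with e Fin.≟ f (edgeTriple tri′) | e′ Fin.≟ g (edgeTriple tri′)
    ...   | yes e≡f | yes e′≡g = contradiction (determine tri tri′ (≡.trans eq e≡f) (≡.trans eq′ e′≡g)) t≢t′
    ...   | yes _   | no  _    = ≤-trans (≤-reflexive (trans (+-congʳ (zeroʳ _)) (+-identityˡ _))) (none tri eq eq′ ts t∉ts)
    ...   | no  _   | _        = ≤-trans (≤-reflexive (trans (+-congʳ (zeroˡ _)) (+-identityˡ _))) (none tri eq eq′ ts t∉ts)

    atMostOne : ∀ ts → Unique ts → ∑[ t ∈ edgeTriples P? ts ] ([ e ≡ f t ] * [ e′ ≡ g t ]) ≤ 1#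
    atMostOne []       []            = 0≤1
    atMostOne (t ∷ ts) (t∉ts ∷ unique) with P? t
    ... | no  _   = atMostOne ts unique
    ... | yes tri with e Fin.≟ f (edgeTriple tri) | e′ Fin.≟ g (edgeTriple tri)
    ...   | yes e≡f | yes e′≡g = ≤-trans (+-mono-≤ (≤-reflexive (*-identityʳ 1#))
                                   (none tri (≡.sym e≡f) (≡.sym e′≡g) ts t∉ts)) (≤-reflexive (+-identityʳ 1#))
    ...   | yes _   | no  _    = ≤-trans (≤-reflexive (trans (+-congʳ (zeroʳ _)) (+-identityˡ _))) (atMostOne ts unique)
    ...   | no  _   | _        = ≤-trans (≤-reflexive (trans (+-congʳ (zeroˡ _)) (+-identityˡ _))) (atMostOne ts unique)

  graphTriples : List (Triple (#edges G))
  graphTriples = edgeTriples (isTriangle? G) vertexTriples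

  sparse : Sparse (fromℕ (maxTrianglesAtEdge G)) graphTriples
  sparse = record
    { 0≤D        = 0≤fromℕ (maxTrianglesAtEdge G)
    ; degree₁    = degree e₁-isSide
    ; degree₂    = degree e₂-isSide
    ; degree₃    = degree e₃-isSide
    ; codegree₁₂ = codegree-edgeTriples e₁e₂-determine (isTriangle? G) triples-unique
    ; codegree₁₃ = codegree-edgeTriples e₁e₃-determine (isTriangle? G) triples-unique
    ; codegree₂₃ = codegree-edgeTriples e₂e₃-determine (isTriangle? G) triples-unique
    }
    where
    degree : ∀ {f} → IsSide f → ∀ e → ∑[ t ∈ graphTriples ] [ e ≡ f t ] ≤ fromℕ (maxTrianglesAtEdge G)
    degree isSide e = ≤-trans
      (degree-edgeTriples isSide (isTriangle? G) e (contains? G (List.lookup (edges G) e)) vertexTriples)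
      (fromℕ-mono-≤ (All.lookup (xs≤max 0 (map (#trianglesAt G) (edges G))) (∈-map⁺ (#trianglesAt G) (∈-lookup e))))

-- Choice of the constants

module Asymptotics {c ℓ₁ ℓ₂} (ℝ : Reals c ℓ₁ ℓ₂) where

  open OrderedField ℝ
  open Exponential ℝ
  open ≤-Reasoning

  x^3≤pow : ∀ {x γ} (0<x : 0# < x) → 1# ≤ x → 0# ≤ γ → x ^ 3 ≤ pow x 0<x (fromℕ 6 + γ)
  x^3≤pow {x} {γ} 0<x 1≤x 0≤γ = begin
    x ^ 3                   ≈⟨ ^-congˡ 3 (exp-log x 0<x) ⟨
    exp y ^ 3               ≈⟨ exp-^ 3 y ⟩
    exp (fromℕ 3 * y)       ≤⟨ exp-mono-≤ (*-monoˡ-≤ 0≤y 3≤6+γ) ⟩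
    exp ((fromℕ 6 + γ) * y) ∎
    where
    y = log x 0<x
    0≤y : 0# ≤ y
    0≤y = exp-cancel-≤ (≤-trans (≤-reflexive exp-0) (≤-trans 1≤x (≤-reflexive (sym (exp-log x 0<x)))))
    3≤6+γ : fromℕ 3 ≤ fromℕ 6 + γ
    3≤6+γ = ≤-trans (fromℕ-mono-≤ {3} {6} (ℕ.m≤m+n 3 3)) (≤-trans (≤-reflexive (sym (+-identityʳ _))) (+-monoʳ-≤ _ 0≤γ))

  /ℕ-cancel : ∀ x d .{{_ : NonZero d}} → fromℕ d * (x /ℕ d) ≈ x
  /ℕ-cancel x (suc d) = trans (solve 3 (λ n x i → n :* (x :* i) := x :* (n :* i)) refl _ x _)
    (trans (*-congˡ (*-inverseʳ (0<1+n d))) (*-identityʳ x))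

  module Constants (K ε : Carrier) (0<K : 0# < K) (0<ε : 0# < ε) where

    private
      ε⁻¹ = ε ⁻¹⟨ 0<ε ⟩

      -- Its inverse ρ equals ε / (4 (1 + ε)), so 4ρ lies below both 1 and ε without a minimum being
      -- computed.
      x : Carrier
      x = fromℕ 4 * (1# + ε⁻¹)

      0<x : 0# < x
      0<x = *-pos (0<1+n 3) (<-≤-trans 0<1 (≤-trans (≤-reflexive (sym (+-identityʳ 1#))) (+-monoʳ-≤ 1# (<⇒≤ (0<⁻¹ 0<ε)))))

    ρ : Carrier
    ρ = x ⁻¹⟨ 0<x ⟩

    0<ρ : 0# < ρ
    0<ρ = 0<⁻¹ 0<x

    0≤ρ : 0# ≤ ρ
    0≤ρ = <⇒≤ 0<ρ

    private
      4ρ[1+ε⁻¹]≈1 : fromℕ 4 * ρ + fromℕ 4 * ρ * ε⁻¹ ≈ 1#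
      4ρ[1+ε⁻¹]≈1 = trans (solve 2 (λ ρ e → ⟪ 4 ⟫ :* ρ :+ ⟪ 4 ⟫ :* ρ :* e := ⟪ 4 ⟫ :* (⟪ 1 ⟫ :+ e) :* ρ) refl ρ ε⁻¹)
        (*-inverseʳ 0<x)

      0≤4ρ : 0# ≤ fromℕ 4 * ρ
      0≤4ρ = *-nonneg (0≤fromℕ 4) 0≤ρ

    4ρ≤1 : fromℕ 4 * ρ ≤ 1#
    4ρ≤1 = begin
      fromℕ 4 * ρ                        ≈⟨ +-identityʳ _ ⟨
      fromℕ 4 * ρ + 0#                   ≤⟨ +-monoʳ-≤ _ (*-nonneg 0≤4ρ (<⇒≤ (0<⁻¹ 0<ε))) ⟩
      fromℕ 4 * ρ + fromℕ 4 * ρ * ε⁻¹    ≈⟨ 4ρ[1+ε⁻¹]≈1 ⟩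
      1#                                 ∎

    4ρ≤ε : fromℕ 4 * ρ ≤ ε
    4ρ≤ε = begin
      fromℕ 4 * ρ                              ≈⟨ *-identityʳ _ ⟨
      fromℕ 4 * ρ * 1#                         ≈⟨ *-congˡ (*-inverseʳ 0<ε) ⟨
      fromℕ 4 * ρ * (ε * ε⁻¹)                  ≈⟨ solve 3 (λ r e i → r :* (e :* i) := e :* (r :* i)) refl _ ε ε⁻¹ ⟩
      ε * (fromℕ 4 * ρ * ε⁻¹)                  ≤⟨ *-monoʳ-≤ (<⇒≤ 0<ε) (≤-trans (≤-trans (≤-reflexive (sym (+-identityˡ _)))
                                                    (+-monoˡ-≤ _ 0≤4ρ)) (≤-reflexive 4ρ[1+ε⁻¹]≈1)) ⟩
      ε * 1#                                   ≈⟨ *-identityʳ ε ⟩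
      ε                                        ∎

    -- The successor makes `c′`, and with it `k` and `threshold`, positive by computation.
    b c′ : ℕ
    b  = proj₁ (archimedean ((K + 1#) * x))
    c′ = suc b

    ĉ : Carrier
    ĉ = fromℕ c′

    K+1≤ρc : K + 1# ≤ ρ * ĉ
    K+1≤ρc = begin
      K + 1#               ≈⟨ *-identityʳ _ ⟨
      (K + 1#) * 1#        ≈⟨ *-congˡ (*-inverseʳ 0<x) ⟨
      (K + 1#) * (x * ρ)   ≈⟨ solve 3 (λ k x r → k :* (x :* r) := r :* (k :* x)) refl (K + 1#) x ρ ⟩
      ρ * ((K + 1#) * x)   ≤⟨ *-monoʳ-≤ 0≤ρ (≤-trans (<⇒≤ (proj₂ (archimedean ((K + 1#) * x)))) (fromℕ-mono-≤ (ℕ.n≤1+n b))) ⟩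
      ρ * ĉ                ∎

    1≤ρc : 1# ≤ ρ * ĉ
    1≤ρc = ≤-trans (≤-trans (≤-reflexive (sym (+-identityˡ 1#))) (+-monoˡ-≤ 1# (<⇒≤ 0<K))) K+1≤ρc

    -- Chosen for `36k²≤ρL³`: as k ≤ 2c′L and 1 ≤ ρc′, one has 36k² ≤ 144c′²L² ≤ ρ 144c′³L², and L ≥
    -- 144c′³ turns this into ρL³.
    threshold : ℕ
    threshold = 144 ℕ.* (c′ ℕ.* (c′ ℕ.* c′))

    1≤threshold : 1# ≤ fromℕ threshold
    1≤threshold = ≤-trans (≤-reflexive (sym (+-identityʳ 1#))) (fromℕ-mono-≤ {1} {threshold} (ℕ.s≤s ℕ.z≤n))

    module NumberOfMoments {L : Carrier} (threshold≤L : fromℕ threshold ≤ L) (l : ℕ) (l≤L : fromℕ l ≤ L) (L<1+l : L < fromℕ (suc l)) where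

      private
        l̂ = fromℕ (suc l)

        1≤L : 1# ≤ L
        1≤L = ≤-trans 1≤threshold threshold≤L

        0≤L : 0# ≤ L
        0≤L = ≤-trans 0≤1 1≤L

        0≤ĉ : 0# ≤ ĉ
        0≤ĉ = 0≤fromℕ c′

        0≤l̂ : 0# ≤ l̂
        0≤l̂ = 0≤fromℕ (suc l)

        l̂≤2L : l̂ ≤ fromℕ 2 * L
        l̂≤2L = ≤-trans (+-mono-≤ 1≤L l≤L) (≤-reflexive (solve 1 (λ L → L :+ L := ⟪ 2 ⟫ :* L) refl L))

      -- With `l` the integer part of L, the number `suc l` lies between L and 2L: the lower bound
      -- gives the decay, the upper one keeps k² of order L².
      k : ℕ
      k = c′ ℕ.* suc l

      1≤k : 1 ℕ.≤ k
      1≤k = ℕ.s≤s ℕ.z≤n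

      [K+1]L≤ρk : (K + 1#) * L ≤ ρ * fromℕ k
      [K+1]L≤ρk = begin
        (K + 1#) * L         ≤⟨ *-mono-≤ (+-nonneg (<⇒≤ 0<K) 0≤1) 0≤l̂ K+1≤ρc (<⇒≤ L<1+l) ⟩
        ρ * ĉ * l̂            ≈⟨ trans (*-congˡ (fromℕ-* c′ (suc l))) (sym (*-assoc ρ ĉ l̂)) ⟨
        ρ * fromℕ k          ∎

      36k²≤ρL³ : fromℕ 36 * (fromℕ k * fromℕ k) ≤ ρ * L ^ 3
      36k²≤ρL³ = begin
        fromℕ 36 * (fromℕ k * fromℕ k)
          ≈⟨ *-congˡ (*-cong (fromℕ-* c′ (suc l)) (fromℕ-* c′ (suc l))) ⟩
        fromℕ 36 * ((ĉ * l̂) * (ĉ * l̂))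
          ≤⟨ *-monoʳ-≤ (0≤fromℕ 36) (*-mono-≤ (*-nonneg 0≤ĉ 0≤l̂) (*-nonneg 0≤ĉ (*-nonneg (0≤fromℕ 2) 0≤L))
               (*-monoʳ-≤ 0≤ĉ l̂≤2L) (*-monoʳ-≤ 0≤ĉ l̂≤2L)) ⟩
        fromℕ 36 * ((ĉ * (fromℕ 2 * L)) * (ĉ * (fromℕ 2 * L)))
          ≈⟨ solve 2 (λ c L → ⟪ 36 ⟫ :* ((c :* (⟪ 2 ⟫ :* L)) :* (c :* (⟪ 2 ⟫ :* L)))
               := ⟪ 1 ⟫ :* (⟪ 144 ⟫ :* c :* c :* L :* L)) refl ĉ L ⟩
        1# * (fromℕ 144 * ĉ * ĉ * L * L)
          ≤⟨ *-monoˡ-≤ (*-nonneg (*-nonneg (*-nonneg (*-nonneg (0≤fromℕ 144) 0≤ĉ) 0≤ĉ) 0≤L) 0≤L) 1≤ρc ⟩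
        ρ * ĉ * (fromℕ 144 * ĉ * ĉ * L * L)
          ≈⟨ solve 4 (λ ρ c L q → ρ :* c :* (q :* c :* c :* L :* L) := ρ :* (q :* (c :* (c :* c)) :* L :^ 2)) refl ρ ĉ L (fromℕ 144) ⟩
        ρ * (fromℕ 144 * (ĉ * (ĉ * ĉ)) * L ^ 2)
          ≈⟨ *-congˡ (*-congʳ (trans (fromℕ-* 144 (c′ ℕ.* (c′ ℕ.* c′))) (*-congˡ (trans (fromℕ-* c′ (c′ ℕ.* c′)) (*-congˡ (fromℕ-* c′ c′)))))) ⟨
        ρ * (fromℕ threshold * L ^ 2)
          ≤⟨ *-monoʳ-≤ 0≤ρ (*-monoˡ-≤ (^-nonneg 2 0≤L) threshold≤L) ⟩
        ρ * L ^ 3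
          ∎

      -- The 36 splits as 27 + 9, one share for each hypothesis on μ.
      concentrated : ∀ {μ d} → 0# ≤ d → L ^ 3 ≤ μ → L ^ 3 * d ≤ μ →
        fromℕ k * fromℕ k * (fromℕ 27 + fromℕ 9 * d) ≤ ρ * μ
      concentrated {μ} {d} 0≤d L³≤μ L³d≤μ = *-cancelˡ-≤ (0<1+n 35) (begin
        fromℕ 36 * (fromℕ k * fromℕ k * (fromℕ 27 + fromℕ 9 * d))
          ≈⟨ *-assoc (fromℕ 36) _ _ ⟨
        fromℕ 36 * (fromℕ k * fromℕ k) * (fromℕ 27 + fromℕ 9 * d)
          ≤⟨ *-monoˡ-≤ (+-nonneg (0≤fromℕ 27) (*-nonneg (0≤fromℕ 9) 0≤d)) 36k²≤ρL³ ⟩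
        ρ * L ^ 3 * (fromℕ 27 + fromℕ 9 * d)
          ≈⟨ solve 3 (λ ρ y d → ρ :* y :* (⟪ 27 ⟫ :+ ⟪ 9 ⟫ :* d) := ρ :* (⟪ 27 ⟫ :* y :+ ⟪ 9 ⟫ :* (y :* d))) refl ρ (L ^ 3) d ⟩
        ρ * (fromℕ 27 * L ^ 3 + fromℕ 9 * (L ^ 3 * d))
          ≤⟨ *-monoʳ-≤ 0≤ρ (+-mono-≤ (*-monoʳ-≤ (0≤fromℕ 27) L³≤μ) (*-monoʳ-≤ (0≤fromℕ 9) L³d≤μ)) ⟩
        ρ * (fromℕ 27 * μ + fromℕ 9 * μ)
          ≈⟨ solve 2 (λ ρ μ → ρ :* (⟪ 27 ⟫ :* μ :+ ⟪ 9 ⟫ :* μ) := ⟪ 36 ⟫ :* (ρ :* μ)) refl ρ μ ⟩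
        fromℕ 36 * (ρ * μ)
          ∎)

      -- The surplus 1 in K + 1 pays for the two tails, as 2 ≤ 1 + L ≤ exp L.
      tails-≤ : fromℕ 2 * exp (- (ρ * fromℕ k)) ≤ exp (- K * L)
      tails-≤ = begin
        fromℕ 2 * exp (- (ρ * fromℕ k))
          ≤⟨ *-mono-≤ (0≤fromℕ 2) (exp-nonneg _) 2≤exp-L (exp-mono-≤ (neg-mono-≤ [K+1]L≤ρk)) ⟩
        exp L * exp (- ((K + 1#) * L))
          ≈⟨ exp-+ L _ ⟨
        exp (L + - ((K + 1#) * L))
          ≈⟨ exp-cong (solve 2 (λ K L → L :+ :- ((K :+ ⟪ 1 ⟫) :* L) := :- K :* L) refl K L) ⟩
        exp (- K * L)
          ∎
        where
        2≤exp-L : fromℕ 2 ≤ exp L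
        2≤exp-L = ≤-trans (≤-reflexive (solve 0 (⟪ 2 ⟫ := ⟪ 1 ⟫ :+ ⟪ 1 ⟫) refl)) (≤-trans (+-monoʳ-≤ 1# 1≤L) (1+x≤exp L))

  -- Both cases of the hypothesis say that p³t ≥ y max (1, p²Δ), with
  -- y = log^(6+γ) n.

  mean-bound : ∀ {p y} → 0# ≤ p → 0# ≤ y → ∀ t Δ →
    (1# ≤ p ^ 2 * fromℕ Δ → .{{_ : NonZero Δ}} → y ≤ (p * t) /ℕ Δ) ×
    (p ^ 2 * fromℕ Δ < 1# → y ≤ p ^ 3 * t) →
    ∀ {a} {A : Set a} → (y ≤ p ^ 3 * t → y * (p ^ 2 * fromℕ Δ) ≤ p ^ 3 * t → ¬ A) → ¬ A
  mean-bound {p} {y} 0≤p 0≤y t Δ (dense , sparse) {A = A} cont = <-cases (p ^ 2 * fromℕ Δ) 1# below (above Δ dense cont)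
    where
    below : p ^ 2 * fromℕ Δ < 1# → ¬ A
    below d<1 = cont (sparse d<1) (≤-trans (≤-trans (*-monoʳ-≤ 0≤y (<⇒≤ d<1)) (≤-reflexive (*-identityʳ y))) (sparse d<1))

    above : ∀ Δ → (1# ≤ p ^ 2 * fromℕ Δ → .{{_ : NonZero Δ}} → y ≤ (p * t) /ℕ Δ) →
      (y ≤ p ^ 3 * t → y * (p ^ 2 * fromℕ Δ) ≤ p ^ 3 * t → ¬ A) → 1# ≤ p ^ 2 * fromℕ Δ → ¬ A
    -- With Δ = 0 the case p²Δ ≥ 1 cannot occur. Matching on Δ here also supplies the `NonZero`
    -- instance that `dense` requires.
    above zero      dense cont 1≤d = contradiction (<-respˡ-≈ (sym (zeroʳ (p ^ 2))) 0<1) 1≤d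
    above Δ@(suc _) dense cont 1≤d = cont
      (≤-trans (≤-trans (≤-reflexive (sym (*-identityʳ y))) (*-monoʳ-≤ 0≤y 1≤d)) yd≤) yd≤
      where
      yd≤ : y * (p ^ 2 * fromℕ Δ) ≤ p ^ 3 * t
      yd≤ = begin
        y * (p ^ 2 * fromℕ Δ)                 ≈⟨ solve 3 (λ y p² d → y :* (p² :* d) := p² :* d :* y) refl y (p ^ 2) _ ⟩
        p ^ 2 * fromℕ Δ * y                   ≤⟨ *-monoʳ-≤ (*-nonneg (^-nonneg 2 0≤p) (0≤fromℕ Δ)) (dense 1≤d) ⟩
        p ^ 2 * fromℕ Δ * ((p * t) /ℕ Δ)      ≈⟨ trans (*-assoc (p ^ 2) _ _) (*-congˡ (/ℕ-cancel (p * t) Δ)) ⟩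
        p ^ 2 * (p * t)                       ≈⟨ solve 2 (λ p t → p :^ 2 :* (p :* t) := p :^ 3 :* t) refl p t ⟩
        p ^ 3 * t                             ∎

-- Concentration of the triangle count for large n

theorem2 : ∀ {c ℓ₁ ℓ₂} (ℝ : Reals c ℓ₁ ℓ₂) → let open RealProperties ℝ in
    (γ K ε : Carrier) → 0# < γ → 0# < K → 0# < ε → (n₀ : ℕ) →
    ∃[ N ]
    ((G : ∀ n → SimpleGraph n) (p : ℕ → Carrier) →
    let t = λ n → fromℕ (#triangles (G n))
        Δ = λ n → maxTrianglesAtEdge (G n)
    in
    (∀ n → 0# ≤ p n × p n ≤ 1#) →
    (∀ n → n₀ ℕ.≤ n →
    (1# ≤ p n ^ 2 * fromℕ (Δ n) → .{{_ : NonZero (Δ n)}} →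
    logPow (fromℕ 6 + γ) n ≤ (p n * t n) /ℕ Δ n) ×
    (p n ^ 2 * fromℕ (Δ n) < 1# →
    logPow (fromℕ 6 + γ) n ≤ p n ^ 3 * t n)) →
    ∀ n → N ℕ.≤ n → let open RandomSubgraph ℝ (G n) (p n) in
    (deviates? : Decidable (Deviates ε)) →
    Pr deviates? ≤ powℕ n (- K))
theorem2 ℝ γ K ε 0<γ 0<K 0<ε n₀ = 2 ℕ.+ (n₀ ℕ.+ N₁) , proof
  where
  open OrderedField ℝ
  open Exponential ℝ
  open Asymptotics ℝ
  open Constants K ε 0<K 0<ε

  -- From here on n exceeds exp `threshold`, so that log n ≥ `threshold`.
  N₁ : ℕ
  N₁ = proj₁ (archimedean (exp (fromℕ threshold)))

  proof : ∀ G p → (∀ n → 0# ≤ p n × p n ≤ 1#) → _ → ∀ n → 2 ℕ.+ (n₀ ℕ.+ N₁) ℕ.≤ n → _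
  -- The two successors make `logPow` and `powℕ` compute. The goal is the negation of `violation`,
  -- which admits the double-negated integer part and the case distinction.
  proof G p 0≤p≤1 hyp n@(suc (suc n′)) (ℕ.s≤s (ℕ.s≤s N≤n′)) deviates? violation =
    ¬¬-floor 0≤L λ (l , l≤L , L<1+l) →
      mean-bound 0≤p (≤-trans (^-nonneg 3 0≤L) L³≤y) (fromℕ (#triangles (G n))) Δ (hyp n n₀≤n)
        (λ y≤μ yd≤μ → bound l l≤L L<1+l (≤-trans L³≤y y≤μ) (≤-trans (*-monoˡ-≤ 0≤d L³≤y) yd≤μ)) violation
    where
    P : Probability ℝ
    P = record { p = p n ; 0≤p = proj₁ (0≤p≤1 n) ; p≤1 = proj₂ (0≤p≤1 n) }

    open Probability P using (0≤p)

    Δ = maxTrianglesAtEdge (G n)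
    μ = p n ^ 3 * fromℕ (#triangles (G n))
    d = p n ^ 2 * fromℕ Δ

    open RandomSubgraph ℝ (G n) (p n) using (Deviates; Pr; 𝔼) renaming (T to T′)
    open Expectation ℝ P
    open Triples ℝ P (#edges (G n)) using (T; E-T)
    open TriangleCount ℝ P (G n)
    open Concentration ℝ P (#edges (G n))
    open GraphTriangles (G n)

    0≤d : 0# ≤ d
    0≤d = *-nonneg (^-nonneg 2 0≤p) (0≤fromℕ Δ)

    -- As `log` takes its positivity proof as an argument, this is the very proof used by `logPow`
    -- and `powℕ`; their logarithms are then `L` by definition.
    0<n : 0# < fromℕ n
    0<n = 0<1+n (suc n′)

    L : Carrier
    L = log (fromℕ n) 0<n

    n₀≤n : n₀ ℕ.≤ n
    n₀≤n = ℕ.≤-trans (ℕ.m≤m+n n₀ N₁) (ℕ.≤-trans N≤n′ (ℕ.m≤n+m n′ 2))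

    N₁≤n : N₁ ℕ.≤ n
    N₁≤n = ℕ.≤-trans (ℕ.m≤n+m N₁ n₀) (ℕ.≤-trans N≤n′ (ℕ.m≤n+m n′ 2))

    threshold≤L : fromℕ threshold ≤ L
    threshold≤L = exp-cancel-≤ (≤-trans (<⇒≤ (proj₂ (archimedean (exp (fromℕ threshold)))))
      (≤-trans (fromℕ-mono-≤ N₁≤n) (≤-reflexive (sym (exp-log (fromℕ n) 0<n)))))

    1≤L : 1# ≤ L
    1≤L = ≤-trans 1≤threshold threshold≤L

    0≤L : 0# ≤ L
    0≤L = ≤-trans 0≤1 1≤L

    L³≤y : L ^ 3 ≤ logPow (fromℕ 6 + γ) n
    L³≤y = x^3≤pow (0<log 0<n (1<2+n n′)) 1≤L (<⇒≤ 0<γ)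

    length≡ : length graphTriples ≡ #triangles (G n)
    length≡ = length-edgeTriples (isTriangle? (G n)) vertexTriples

    μ≈ : p n ^ 3 * fromℕ (length graphTriples) ≈ μ
    μ≈ = reflexive (≡.cong (λ l → p n ^ 3 * fromℕ l) length≡)

    T≈T : ∀ S → T′ S ≈ T graphTriples S
    T≈T S = T-edgeTriples (isTriangle? (G n)) S (isTriangle? (subgraph (G n) S)) vertexTriples

    mean : 𝔼 T′ ≈ p n ^ 3 * fromℕ (length graphTriples)
    mean = trans (𝔼≈E _ T′) (trans (E-cong _ T≈T) (E-T graphTriples))

    deviates : ∀ S → Deviates ε S →
      ε * (p n ^ 3 * fromℕ (length graphTriples)) ≤ abs (T graphTriples S - p n ^ 3 * fromℕ (length graphTriples))
    deviates S dev = ≤-trans (≤-reflexive (*-congˡ (sym mean)))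
      (≤-trans dev (≤-reflexive (abs-cong (+-cong (T≈T S) (-‿cong mean)))))

    bound : ∀ l → fromℕ l ≤ L → L < fromℕ (suc l) → L ^ 3 ≤ μ → L ^ 3 * d ≤ μ → Pr deviates? ≤ powℕ n (- K)
    bound l l≤L L<1+l L³≤μ L³d≤μ = ≤-trans (Tails.concentration sparse 0<ρ 4ρ≤1 k 1≤k
      (≤-trans (concentrated 0≤d L³≤μ L³d≤μ) (≤-reflexive (*-congˡ (sym μ≈)))) deviates? 4ρ≤ε deviates) tails-≤
      where open NumberOfMoments threshold≤L l l≤L L<1+l
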